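{- Let $P$ be a polytope such that its slack matrix $S(P)$ is a $0/1$ matrix. Then $\operatorname{xc}_{\mathrm{SDP}}(P)\leqslant\dim(P)+2$.
   Context: Slack matrix: for a polytope $P=\{x\in\mathbb{R}^d\mid Ax\leqslant b\}=\operatorname{conv}(V)$ with $V=\{v_1,\ldots,v_n\}$, the slack matrix of $P$ w.r.t. $Ax\leqslant b$ and $V$ has entries $S_{ij}=b_i-A_iv_j$, where $A_i$ is the $i$th row of $A$. $S(P)$ denotes the submatrix whose rows correspond to the facets of $P$ (one facet-defining inequality per facet) and whose columns correspond to the vertices of $P$; since a facet-defining inequality may be scaled by a positive number, the hypothesis is that $S(P)$ is $0/1$ for some choice of facet-defining inequalities. $\dim(P)$ is the dimension of the affine hull of $P$. $\mathbb{S}^r_+$ is the cone of $r\times r$ real symmetric positive semidefinite matrices, embedded in $\mathbb{R}^{r(r+1)/2}$ in such a way that the scalar product of two elements equals the Frobenius product of the corresponding matrices. A semidefinite extended formulation of size $r$ of a polytope $P\subseteq\mathbb{R}^d$ is a system $Ex+Fy=g,\ y\in\mathbb{S}^r_+$ (with real matrices $E,F$ and real vector $g$) such that $P=\{x\in\mathbb{R}^d\mid\exists y:\ Ex+Fy=g,\ y\in\mathbb{S}^r_+\}$. The semidefinite extension complexity $\operatorname{xc}_{\mathrm{SDP}}(P)$ is the minimum $r$ such that $P$ has a semidefinite extended formulation of size $r$. -}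

module Defs where

open import Algebra.Bundles using (CommutativeRing)
open import Data.Fin.Base using (Fin)
open import Data.Integer.Base as ℤ using (ℤ; +_)
open import Data.Nat.Base as ℕ using (ℕ)
open import Data.Product.Base using (Σ; ∃; ∃-syntax; _×_)
open import Data.Sum.Base using (_⊎_)
open import Data.Vec.Functional using (Vector)
open import Level using (0ℓ; suc)
open import Relation.Binary.Core using (Rel)
open import Relation.Binary.PropositionalEquality.Core using (_≡_)
open import Relation.Binary.Structures using (IsTotalOrder)
open import Relation.Nullary.Negation.Core using (¬_)
open import Relation.Unary using (Pred; _∈_; _⊆_; _≐_)
import Algebra.Properties.Semiring.Sum as Sum
import Data.Vec.Functional.Relation.Binary.Equality.Setoid as Pointwise
import Relation.Binary.Construct.NonStrictToStrict as Strict

-- The real numbers, axiomatised (uniquely up to isomorphism) as a complete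
-- ordered field.  Suprema are characterised by approximation: every y below
-- the supremum lies below some element of the set.  Together with totality of
-- the order, this makes excluded middle for Set derivable, so the theory of
-- this record is the classical one.

record RealField : Set (suc 0ℓ) where
  infix 4 _≤_
  field
    commutativeRing : CommutativeRing 0ℓ 0ℓ

  open CommutativeRing commutativeRing public

  field
    1≉0            : ¬ (1# ≈ 0#)
    inverse        : ∀ x → ¬ (x ≈ 0#) → ∃[ y ] x * y ≈ 1#
    _≤_            : Rel Carrier 0ℓ
    isTotalOrder   : IsTotalOrder _≈_ _≤_
    +-monoˡ-≤      : ∀ {x y} z → x ≤ y → x + z ≤ y + z
    *-nonNegative  : ∀ {x y} → 0# ≤ x → 0# ≤ y → 0# ≤ x * y

  open Strict _≈_ _≤_ public using (_<_)

  UpperBound : Pred Carrier 0ℓ → Pred Carrier 0ℓ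
  UpperBound S u = ∀ {x} → x ∈ S → x ≤ u

  IsSupremum : Pred Carrier 0ℓ → Pred Carrier 0ℓ
  IsSupremum S s = UpperBound S s × (∀ {y} → y < s → ∃[ x ] x ∈ S × y < x)

  field
    complete : (S : Pred Carrier 0ℓ) → ∃ S → ∃ (UpperBound S) → ∃ (IsSupremum S)

module Polytopes (ℝ : RealField) where

  open RealField ℝ
  open Sum semiring using (sum; sum-syntax)
  open Pointwise setoid using (_≋_)

  Point : ℕ → Set
  Point d = Vector Carrier d

  Matrix : ℕ → ℕ → Set
  Matrix m n = Vector (Point n) m

  PointSet : ℕ → Set₁
  PointSet d = Pred (Point d) 0ℓ

  infix 7 _·_

  _·_ : ∀ {d} → Point d → Point d → Carrier
  _·_ {d} x y = ∑[ i < d ] (x i * y i)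

  combination : ∀ {d n} → Vector Carrier n → Vector (Point d) n → Point d
  combination {n = n} c p k = ∑[ i < n ] (c i * p i k)

  ------------------------------------------------------------------------
  -- Affine hulls and dimension

  Aff : ∀ {d} → PointSet d → PointSet d
  Aff {d} X x =
    ∃[ n ] Σ (Vector (Point d) n) λ p → Σ (Vector Carrier n) λ c →
      (∀ i → p i ∈ X) × sum c ≈ 1# × x ≋ combination c p

  AffinelyIndependent : ∀ {d n} → Pred (Vector (Point d) n) 0ℓ
  AffinelyIndependent {n = n} p =
    (c : Vector Carrier n) → sum c ≈ 0# → (∀ k → combination c p k ≈ 0#) →
    ∀ i → c i ≈ 0#

  IsAffineBasis : ∀ {d n} → PointSet d → Pred (Vector (Point d) n) 0ℓ
  IsAffineBasis L p =
    (∀ i → p i ∈ L) × AffinelyIndependent p × L ⊆ Aff (λ x → ∃[ i ] x ≋ p i)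

  -- "dim X = k".  An affine basis of an affine space of dimension k has k + 1
  -- points; in particular the empty set has dimension -1.
  HasDim : ∀ {d} → PointSet d → ℤ → Set
  HasDim {d} X k =
    ∃[ n ] k ≡ + n ℤ.- + 1 × Σ (Vector (Point d) n) (IsAffineBasis (Aff X))

  ------------------------------------------------------------------------
  -- Polytopes, faces and slack matrices

  Polyhedron : ∀ {d m} → Matrix m d → Vector Carrier m → PointSet d
  Polyhedron A b x = ∀ i → A i · x ≤ b i

  Conv : ∀ {d n} → Vector (Point d) n → PointSet d
  Conv {n = n} V x =
    Σ (Vector Carrier n) λ c →
      (∀ i → 0# ≤ c i) × sum c ≈ 1# × x ≋ combination c V

  record Polytope (d : ℕ) : Set where
    field
      {m n}       : ℕ
      A           : Matrix m d
      b           : Vector Carrier m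
      V           : Vector (Point d) n
      description : Polyhedron A b ≐ Conv V

    points : PointSet d
    points = Polyhedron A b

  Valid : ∀ {d} → PointSet d → Point d → Carrier → Set
  Valid X a β = ∀ {x} → x ∈ X → a · x ≤ β

  Face : ∀ {d} → PointSet d → Point d → Carrier → PointSet d
  Face X a β x = x ∈ X × a · x ≈ β

  FacetDefining : ∀ {d} → PointSet d → Point d → Carrier → Set
  FacetDefining X a β =
    Valid X a β × ∃[ k ] HasDim X k × HasDim (Face X a β) (k ℤ.- + 1)

  IsVertex : ∀ {d} → PointSet d → PointSet d
  IsVertex {d} X v =
    Σ (Point d) λ a → ∃[ β ]
      Valid X a β × HasDim (Face X a β) (+ 0) × v ∈ Face X a β

  -- One defining inequality for each facet.
  record FacetSystem {d} (X : PointSet d) : Set where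
    field
      {size}        : ℕ
      normal        : Matrix size d
      offset        : Vector Carrier size
      facetDefining : ∀ i → FacetDefining X (normal i) (offset i)
      exhaustive    : ∀ a β → FacetDefining X a β →
                      ∃[ i ] Face X (normal i) (offset i) ≐ Face X a β
      distinct      : ∀ i j →
                      Face X (normal i) (offset i) ≐ Face X (normal j) (offset j) →
                      i ≡ j

  record VertexSystem {d} (X : PointSet d) : Set where
    field
      {size}     : ℕ
      vertex     : Vector (Point d) size
      isVertex   : ∀ j → IsVertex X (vertex j)
      exhaustive : ∀ v → IsVertex X v → ∃[ j ] vertex j ≋ v
      distinct   : ∀ i j → vertex i ≋ vertex j → i ≡ j

  slack : ∀ {d m n} → Matrix m d → Vector Carrier m → Vector (Point d) n → Matrix m n
  slack A b V i j = b i - A i · V j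

  -- S(P).  It depends on the choice of the facet-defining inequalities, since
  -- these can be scaled by positive numbers.
  slackMatrix : ∀ {d} {X : PointSet d} (F : FacetSystem X) (W : VertexSystem X) →
                Matrix (FacetSystem.size F) (VertexSystem.size W)
  slackMatrix F W =
    slack (FacetSystem.normal F) (FacetSystem.offset F) (VertexSystem.vertex W)

  Is0/1 : ∀ {m n} → Pred (Matrix m n) 0ℓ
  Is0/1 S = ∀ i j → S i j ≈ 0# ⊎ S i j ≈ 1#

  ------------------------------------------------------------------------
  -- Semidefinite extended formulations

  Symmetric : ∀ {r} → Pred (Matrix r r) 0ℓ
  Symmetric M = ∀ i j → M i j ≈ M j i

  PSD : ∀ {r} → Pred (Matrix r r) 0ℓ
  PSD {r} M =
    Symmetric M × (∀ (x : Point r) → 0# ≤ ∑[ i < r ] ∑[ j < r ] (x i * M i j * x j))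

  frobenius : ∀ {r} → Matrix r r → Matrix r r → Carrier
  frobenius {r} M N = ∑[ i < r ] ∑[ j < r ] (M i j * N i j)

  -- The embedding of symmetric matrices into ℝ^(r(r+1)/2) is a linear
  -- isomorphism turning the Frobenius product into the scalar product, so a row
  -- of F is represented by the symmetric matrix it is the image of.
  record SDPFormulation {d} (X : PointSet d) (r : ℕ) : Set where
    field
      {equations} : ℕ
      E           : Matrix equations d
      F           : Vector (Matrix r r) equations
      F-symmetric : ∀ e → Symmetric (F e)
      g           : Vector Carrier equations
      projects    : X ≐ λ x → Σ (Matrix r r) λ Y →
                      PSD Y × (∀ e → E e · x + frobenius (F e) Y ≈ g e)

  -- "xc_SDP(X) = r"
  IsXcSDP : ∀ {d} → PointSet d → ℕ → Set
  IsXcSDP X r = SDPFormulation X r × (∀ s → SDPFormulation X s → r ℕ.≤ s)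

module Submission where

open import Defs
open import Algebra.Solver.Ring.AlmostCommutativeRing using (fromCommutativeRing; _-Raw-AlmostCommutative⟶_)
open import Data.Fin.Base using (Fin; zero; suc; punchIn; splitAt; _↑ˡ_; _↑ʳ_)
open import Data.Fin.Subset using (Subset; inside; _⊃_) renaming (_∈_ to _∈ˢ_)
open import Data.Fin.Subset.Induction using (⊃-wellFounded)
open import Data.Integer.Base as ℤ using (ℤ; +_; -[1+_])
open import Data.Maybe.Base using (Maybe; just; nothing)
open import Data.Nat.Base as ℕ using (ℕ; zero; suc)
open import Data.Nat.Induction using (<-wellFounded)
open import Data.Product.Base using (Σ; ∃; ∃-syntax; _×_; _,_; proj₁; proj₂)
open import Data.Sign.Base as Sign using (Sign)
open import Data.Sum.Base using (_⊎_; inj₁; inj₂)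
open import Data.Vec.Base using (tabulate)
open import Data.Vec.Functional using (Vector; []; _∷_; head; tail; _++_; insertAt; removeAt)
open import Data.Vec.Functional.Properties using (insertAt-lookup; insertAt-punchIn; lookup-++ˡ; lookup-++ʳ)
open import Data.Vec.Properties using (lookup∘tabulate; lookup⇒[]=; []=⇒lookup)
open import Function.Base using (_∘_)
open import Induction.WellFounded using (Acc; acc)
open import Relation.Binary.PropositionalEquality.Core as ≡ using (_≡_)
open import Relation.Binary.Structures using (IsTotalOrder)
open import Relation.Nullary.Decidable using (Dec; yes; no; does; decidable-stable)
open import Relation.Nullary.Negation.Core using (¬_; contradiction)
open import Relation.Unary using (_∈_; _⊆_; _≐_)
import Algebra.Properties.Ring
import Algebra.Properties.Semiring.Mult.TCOptimised
import Algebra.Properties.Semiring.Sum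
import Algebra.Solver.Ring
import Data.Integer.Properties as ℤ
import Data.Nat.Properties as ℕ
import Data.Vec.Functional.Relation.Binary.Equality.Setoid
import Relation.Binary.Reasoning.Setoid

-- Let p be an affine basis of aff P, with n = dim P + 1 points, and let
-- t_i ∈ ℝⁿ hold the slacks of the i-th facet inequality at p.  A point
-- x = Σ λ_l p_l, Σ λ_l = 1, has i-th slack ⟨t_i, λ⟩.  The formulation of size
-- n + 1 asks for a positive semidefinite Y whose first row contains such a λ and
-- whose lower right block Z satisfies ⟨t_i t_iᵀ, Z⟩ = slack_i(x) for all i.
-- Every solution has nonnegative slacks, so x ∈ P: a functional separating a
-- point of aff P from P can be tilted around its zeros until it defines a facet.
-- A vertex v lifts to (1,λ)(1,λ)ᵀ because its slacks satisfy σ² = σ, and then so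
-- does every point of P, because the condition on (x, Y) is convex and a point
-- that is not a vertex lies between two points with more tight inequalities.

-- At any positive semidefinite Z the form ⟨t_i t_iᵀ, Z⟩ is nonnegative, so equating it with the
-- slack encodes the facet inequality. At Z = λλᵀ it is the square of the slack, which is why only
-- slacks 0 and 1 admit rank-one lifts. The first row of Y keeps λ available linearly and thereby
-- ties x to aff P: facet inequalities are strict at a relative interior point, so by themselves
-- they never cut a lower-dimensional P out of ℝᵈ. The size is thus one for this row plus dim P + 1
-- barycentric coordinates. The obstacle is that the hypothesis speaks of facets and vertices, which
-- are characterised by dimensions of faces, whereas a `Polytope` comes with an arbitrary system
-- `A`, `b` and an arbitrary generating family `V`, either of which may be redundant. Two dual
-- arguments bridge the gap, both by induction on the set of tight members: points are moved until
-- more rows of `A` become tight, functionals are tilted until more members of `V` do. All case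
-- distinctions rest on excluded middle, which completeness provides.

-- Ring solver with integer coefficients

module IntegerSolver (ℝ : RealField) where

  open RealField ℝ
  open Algebra.Properties.Ring ring
  open Algebra.Properties.Semiring.Mult.TCOptimised semiring renaming (_×_ to _⨯_)
  open Relation.Binary.Reasoning.Setoid setoid

  private
    -- Equality of integers is decided by computation, unlike equality of reals, so integer
    -- coefficients let the solver cancel numerals. With this version of the multiple, `con (+ 1)`
    -- evaluates to `1#` itself.
    ⟦_⟧ : ℤ → Carrier
    ⟦ + n ⟧      = n ⨯ 1#
    ⟦ -[1+ n ] ⟧ = - (suc n ⨯ 1#)

    -‿homo : ∀ i → ⟦ ℤ.- i ⟧ ≈ - ⟦ i ⟧
    -‿homo (+ zero)  = sym -0#≈0#
    -‿homo (+ suc n) = refl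
    -‿homo -[1+ n ]  = sym (-‿involutive _)

    ⊖-homo : ∀ m n → ⟦ m ℤ.⊖ n ⟧ ≈ m ⨯ 1# - n ⨯ 1#
    ⊖-homo m       zero    = sym (trans (+-congˡ -0#≈0#) (+-identityʳ _))
    ⊖-homo zero    (suc n) = sym (+-identityˡ _)
    ⊖-homo (suc m) (suc n) = begin
      ⟦ suc m ℤ.⊖ suc n ⟧                ≡⟨ ≡.cong ⟦_⟧ (ℤ.[1+m]⊖[1+n]≡m⊖n m n) ⟩
      ⟦ m ℤ.⊖ n ⟧                        ≈⟨ ⊖-homo m n ⟩
      m ⨯ 1# - n ⨯ 1#                    ≈⟨ +-congˡ (+-identityˡ _) ⟨
      m ⨯ 1# + (0# - n ⨯ 1#)             ≈⟨ +-congˡ (+-congʳ (-‿inverseʳ 1#)) ⟨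
      m ⨯ 1# + (1# - 1# - n ⨯ 1#)        ≈⟨ +-congˡ (+-assoc _ _ _) ⟩
      m ⨯ 1# + (1# + (- 1# - n ⨯ 1#))    ≈⟨ +-assoc _ _ _ ⟨
      m ⨯ 1# + 1# + (- 1# - n ⨯ 1#)      ≈⟨ +-cong (+-comm _ _) (-‿+-comm _ _) ⟩
      1# + m ⨯ 1# - (1# + n ⨯ 1#)        ≈⟨ +-cong (1+× m 1#) (-‿cong (1+× n 1#)) ⟨
      suc m ⨯ 1# - suc n ⨯ 1#            ∎

    +-homo : ∀ i j → ⟦ i ℤ.+ j ⟧ ≈ ⟦ i ⟧ + ⟦ j ⟧
    +-homo (+ m)    (+ n)    = ×-homo-+ 1# m n
    +-homo (+ m)    -[1+ n ] = ⊖-homo m (suc n)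
    +-homo -[1+ m ] (+ n)    = trans (⊖-homo n (suc m)) (+-comm _ _)
    +-homo -[1+ m ] -[1+ n ] = begin
      - (suc (suc (m ℕ.+ n)) ⨯ 1#)     ≡⟨ ≡.cong (λ k → - (suc k ⨯ 1#)) (ℕ.+-suc m n) ⟨
      - ((suc m ℕ.+ suc n) ⨯ 1#)       ≈⟨ -‿cong (×-homo-+ 1# (suc m) (suc n)) ⟩
      - (suc m ⨯ 1# + suc n ⨯ 1#)      ≈⟨ -‿+-comm _ _ ⟨
      - (suc m ⨯ 1#) - suc n ⨯ 1#      ∎

    -◃-homo : ∀ n → ⟦ Sign.- ℤ.◃ n ⟧ ≈ - (n ⨯ 1#)
    -◃-homo zero    = sym -0#≈0#
    -◃-homo (suc n) = refl

    +◃-homo : ∀ n → ⟦ Sign.+ ℤ.◃ n ⟧ ≈ n ⨯ 1#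
    +◃-homo zero    = refl
    +◃-homo (suc n) = refl

    *-homo : ∀ i j → ⟦ i ℤ.* j ⟧ ≈ ⟦ i ⟧ * ⟦ j ⟧
    *-homo (+ m)    (+ n)    = trans (+◃-homo (m ℕ.* n)) (×1-homo-* m n)
    *-homo (+ m)    -[1+ n ] = begin
      _                         ≈⟨ -◃-homo (m ℕ.* suc n) ⟩
      - ((m ℕ.* suc n) ⨯ 1#)    ≈⟨ -‿cong (×1-homo-* m (suc n)) ⟩
      - (m ⨯ 1# * suc n ⨯ 1#)   ≈⟨ -‿distribʳ-* _ _ ⟩
      m ⨯ 1# * - (suc n ⨯ 1#)   ∎
    *-homo -[1+ m ] (+ n)    = begin
      _                         ≈⟨ -◃-homo (suc m ℕ.* n) ⟩
      - ((suc m ℕ.* n) ⨯ 1#)    ≈⟨ -‿cong (×1-homo-* (suc m) n) ⟩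
      - (suc m ⨯ 1# * n ⨯ 1#)   ≈⟨ -‿distribˡ-* _ _ ⟩
      - (suc m ⨯ 1#) * n ⨯ 1#   ∎
    *-homo -[1+ m ] -[1+ n ] = begin
      _                                   ≈⟨ +◃-homo (suc m ℕ.* suc n) ⟩
      (suc m ℕ.* suc n) ⨯ 1#              ≈⟨ ×1-homo-* (suc m) (suc n) ⟩
      suc m ⨯ 1# * suc n ⨯ 1#             ≈⟨ -‿involutive _ ⟨
      - - (suc m ⨯ 1# * suc n ⨯ 1#)       ≈⟨ -‿cong (-‿distribʳ-* _ _) ⟩
      - (suc m ⨯ 1# * - (suc n ⨯ 1#))     ≈⟨ -‿distribˡ-* _ _ ⟩
      - (suc m ⨯ 1#) * - (suc n ⨯ 1#)     ∎

    homomorphism : ℤ.+-*-rawRing -Raw-AlmostCommutative⟶ fromCommutativeRing commutativeRing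
    homomorphism = record
      { ⟦_⟧    = ⟦_⟧
      ; +-homo = +-homo
      ; *-homo = *-homo
      ; -‿homo = -‿homo
      ; 0-homo = refl
      ; 1-homo = refl
      }

    _coeff≟_ : ∀ i j → Maybe (⟦ i ⟧ ≈ ⟦ j ⟧)
    i coeff≟ j with i ℤ.≟ j
    ... | yes ≡.refl = just refl
    ... | no _       = nothing

  open Algebra.Solver.Ring ℤ.+-*-rawRing (fromCommutativeRing commutativeRing) homomorphism _coeff≟_ public
    using (solve; con; _:=_; _:+_; _:*_; _:-_; :-_)

-- Ordered-field arithmetic and excluded middle

module RealProperties (ℝ : RealField) where

  open RealField ℝ
  open IntegerSolver ℝ
  open Algebra.Properties.Ring ring public using (-0#≈0#)
  open Relation.Binary.Reasoning.Setoid setoid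

  open IsTotalOrder isTotalOrder public using (antisym; total)
    renaming (refl to ≤-refl; reflexive to ≤-reflexive; trans to ≤-trans)

  ≤-resp-≈ : ∀ {x x′ y y′} → x ≈ x′ → y ≈ y′ → x ≤ y → x′ ≤ y′
  ≤-resp-≈ x≈x′ y≈y′ x≤y = ≤-trans (≤-reflexive (sym x≈x′)) (≤-trans x≤y (≤-reflexive y≈y′))

  ≤-respʳ : ∀ {x y y′} → y ≈ y′ → x ≤ y → x ≤ y′
  ≤-respʳ = ≤-resp-≈ refl

  x≤y⇒0≤y-x : ∀ {x y} → x ≤ y → 0# ≤ y - x
  x≤y⇒0≤y-x {x} x≤y = ≤-resp-≈ (-‿inverseʳ x) refl (+-monoˡ-≤ (- x) x≤y)

  0≤y-x⇒x≤y : ∀ {x y} → 0# ≤ y - x → x ≤ y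
  0≤y-x⇒x≤y {x} {y} 0≤y-x =
    ≤-resp-≈ (+-identityˡ x) (solve 2 (λ x y → y :- x :+ x := y) refl x y) (+-monoˡ-≤ x 0≤y-x)

  +-nonNegative : ∀ {x y} → 0# ≤ x → 0# ≤ y → 0# ≤ x + y
  +-nonNegative {x} {y} 0≤x 0≤y = ≤-trans 0≤y (≤-resp-≈ (+-identityˡ y) refl (+-monoˡ-≤ y 0≤x))

  +-mono-≤ : ∀ {w x y z} → w ≤ x → y ≤ z → w + y ≤ x + z
  +-mono-≤ {w} {x} {y} {z} w≤x y≤z =
    ≤-trans (+-monoˡ-≤ y w≤x) (≤-resp-≈ (+-comm y x) (+-comm z x) (+-monoˡ-≤ x y≤z))

  neg-nonNegative : ∀ {x} → x ≤ 0# → 0# ≤ - x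
  neg-nonNegative x≤0 = ≤-respʳ (+-identityˡ _) (x≤y⇒0≤y-x x≤0)

  *-monoˡ-≤-nonNeg : ∀ {x y} z → 0# ≤ z → x ≤ y → z * x ≤ z * y
  *-monoˡ-≤-nonNeg {x} {y} z 0≤z x≤y = 0≤y-x⇒x≤y (≤-respʳ
    (solve 3 (λ x y z → z :* (y :- x) := z :* y :- z :* x) refl x y z)
    (*-nonNegative 0≤z (x≤y⇒0≤y-x x≤y)))

  square-nonNegative : ∀ x → 0# ≤ x * x
  square-nonNegative x with total 0# x
  ... | inj₁ 0≤x = *-nonNegative 0≤x 0≤x
  ... | inj₂ x≤0 = ≤-respʳ (solve 1 (λ x → :- x :* :- x := x :* x) refl x)
                     (*-nonNegative (neg-nonNegative x≤0) (neg-nonNegative x≤0))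

  0≤1 : 0# ≤ 1#
  0≤1 = ≤-respʳ (*-identityˡ 1#) (square-nonNegative 1#)

  1≰0 : ¬ (1# ≤ 0#)
  1≰0 1≤0 = 1≉0 (antisym 1≤0 0≤1)

  2# : Carrier
  2# = 1# + 1#

  2≉0 : ¬ (2# ≈ 0#)
  2≉0 2≈0 = 1≰0 (≤-resp-≈ (+-identityʳ 1#) 2≈0 (+-mono-≤ ≤-refl 0≤1))

  -- The supremum of {0} ∪ {1 | A} is positive exactly when A holds, and the
  -- order being total decides on which side of 1/2 it lies.
  em : (A : Set) → Dec A
  em A with inverse 2# 2≉0
  ... | ½ , 2½≈1 = decide (complete S (0# , inj₁ refl) (1# , bounded))
    where
    S : Carrier → Set
    S x = x ≈ 0# ⊎ (x ≈ 1# × A)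

    bounded : UpperBound S 1#
    bounded (inj₁ x≈0)       = ≤-trans (≤-reflexive x≈0) 0≤1
    bounded (inj₂ (x≈1 , _)) = ≤-reflexive x≈1

    ½≰0 : ¬ (½ ≤ 0#)
    ½≰0 ½≤0 = 1≰0 (≤-resp-≈ (trans (solve 1 (λ h → h :+ h := (con (+ 1) :+ con (+ 1)) :* h) refl ½) 2½≈1)
                     (+-identityʳ 0#) (+-mono-≤ ½≤0 ½≤0))

    1≰½ : ¬ (1# ≤ ½)
    1≰½ 1≤½ = ½≰0 (≤-resp-≈
      (trans (+-congʳ (sym 2½≈1)) (solve 1 (λ h → (con (+ 1) :+ con (+ 1)) :* h :- h := h) refl ½))
      (-‿inverseʳ ½) (+-monoˡ-≤ (- ½) 1≤½))

    decide : ∃ (IsSupremum S) → Dec A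
    decide (s , upper , approx) with total s ½
    ... | inj₁ s≤½ = no λ a → 1≰½ (≤-trans (upper (inj₂ (refl , a))) s≤½)
    ... | inj₂ ½≤s with approx {0#} (≤-trans (upper (inj₁ refl)) ≤-refl , λ 0≈s → ½≰0 (≤-respʳ (sym 0≈s) ½≤s))
    ...   | x , inj₁ x≈0 , _ , 0≉x = contradiction (sym x≈0) 0≉x
    ...   | x , inj₂ (_ , a) , _   = yes a

  ≰⇒≥ : ∀ {x y} → ¬ (x ≤ y) → y ≤ x
  ≰⇒≥ {x} {y} x≰y with total x y
  ... | inj₁ x≤y = contradiction x≤y x≰y
  ... | inj₂ y≤x = y≤x

  -- Junk value: 0# ⁻¹ = 0#.
  infix 9 _⁻¹
  _⁻¹ : Carrier → Carrier
  x ⁻¹ with em (x ≈ 0#)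
  ... | yes _  = 0#
  ... | no x≉0 = proj₁ (inverse x x≉0)

  *-inverseʳ : ∀ {x} → ¬ (x ≈ 0#) → x * x ⁻¹ ≈ 1#
  *-inverseʳ {x} x≉0 with em (x ≈ 0#)
  ... | yes x≈0 = contradiction x≈0 x≉0
  ... | no x≉0′ = proj₂ (inverse x x≉0′)

  xy≈0⇒y≈0 : ∀ {x y} → ¬ (x ≈ 0#) → x * y ≈ 0# → y ≈ 0#
  xy≈0⇒y≈0 {x} {y} x≉0 xy≈0 = begin
    y                ≈⟨ *-identityˡ y ⟨
    1# * y           ≈⟨ *-congʳ (*-inverseʳ x≉0) ⟨
    x * x ⁻¹ * y     ≈⟨ solve 3 (λ x z y → x :* z :* y := z :* (x :* y)) refl x (x ⁻¹) y ⟩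
    x ⁻¹ * (x * y)   ≈⟨ *-congˡ xy≈0 ⟩
    x ⁻¹ * 0#        ≈⟨ zeroʳ _ ⟩
    0#               ∎

  square≈0⇒≈0 : ∀ {x} → x * x ≈ 0# → x ≈ 0#
  square≈0⇒≈0 {x} x²≈0 with em (x ≈ 0#)
  ... | yes x≈0 = x≈0
  ... | no x≉0  = xy≈0⇒y≈0 x≉0 x²≈0

  xy-nonNegative⇒y-nonNegative : ∀ {x y} → 0# ≤ x → ¬ (x ≈ 0#) → 0# ≤ x * y → 0# ≤ y
  xy-nonNegative⇒y-nonNegative {x} {y} 0≤x x≉0 0≤xy with total 0# y
  ... | inj₁ 0≤y = 0≤y
  ... | inj₂ y≤0 = ≤-reflexive (sym (xy≈0⇒y≈0 x≉0 (antisym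
                     (≤-respʳ (zeroʳ x) (*-monoˡ-≤-nonNeg x 0≤x y≤0)) 0≤xy)))

  ⁻¹-nonNegative : ∀ {x} → 0# ≤ x → 0# ≤ x ⁻¹
  ⁻¹-nonNegative {x} 0≤x with em (x ≈ 0#)
  ... | yes _  = ≤-refl
  ... | no x≉0 = xy-nonNegative⇒y-nonNegative 0≤x x≉0 (≤-respʳ (sym (proj₂ (inverse x x≉0))) 0≤1)

-- Linear algebra: functionals, spans and independence

module LinearAlgebra (ℝ : RealField) where

  open RealField ℝ hiding (zero)
  open Polytopes ℝ
  open IntegerSolver ℝ
  open RealProperties ℝ
  open Algebra.Properties.Semiring.Sum semiring
  open Data.Vec.Functional.Relation.Binary.Equality.Setoid setoid using (_≋_; ≋-refl; ≋-sym; ≋-trans)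
  open Relation.Binary.Reasoning.Setoid setoid

  sum-zero : ∀ {n} {f : Vector Carrier n} → (∀ i → f i ≈ 0#) → sum f ≈ 0#
  sum-zero {n} f≈0 = trans (sum-cong-≋ f≈0) (sum-replicate-zero n)

  sum-nonNegative : ∀ {n} {f : Vector Carrier n} → (∀ i → 0# ≤ f i) → 0# ≤ sum f
  sum-nonNegative {ℕ.zero}  0≤f = ≤-refl
  sum-nonNegative {ℕ.suc n} 0≤f = +-nonNegative (0≤f zero) (sum-nonNegative (0≤f ∘ suc))

  sum≈0⇒≈0 : ∀ {n} {f : Vector Carrier n} → (∀ i → 0# ≤ f i) → sum f ≈ 0# → ∀ i → f i ≈ 0#
  sum≈0⇒≈0 {ℕ.suc n} {f} 0≤f Σf≈0 = λ { zero → f₀≈0 ; (suc i) → sum≈0⇒≈0 (0≤f ∘ suc) Σtail≈0 i }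
    where
    f₀≈0 : f zero ≈ 0#
    f₀≈0 = antisym
      (≤-resp-≈ (+-identityʳ _) Σf≈0 (+-mono-≤ ≤-refl (sum-nonNegative (0≤f ∘ suc))))
      (0≤f zero)

    Σtail≈0 : sum (tail f) ≈ 0#
    Σtail≈0 = trans (sym (+-identityˡ _)) (trans (+-congʳ (sym f₀≈0)) Σf≈0)

  sum-mono-≤ : ∀ {n} {f g : Vector Carrier n} → (∀ i → f i ≤ g i) → sum f ≤ sum g
  sum-mono-≤ {ℕ.zero}  f≤g = ≤-refl
  sum-mono-≤ {ℕ.suc n} f≤g = +-mono-≤ (f≤g zero) (sum-mono-≤ (f≤g ∘ suc))

  -- One operation serves for moving points along a line, tilting functionals and eliminating in
  -- rows, since all of these are plain vectors.
  shift : ∀ {n} → Vector Carrier n → Carrier → Vector Carrier n → Vector Carrier n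
  shift x t u k = x k + t * u k

  ·-cong : ∀ {n} {x x′ y y′ : Point n} → x ≋ x′ → y ≋ y′ → x · y ≈ x′ · y′
  ·-cong x≋x′ y≋y′ = sum-cong-≋ λ i → *-cong (x≋x′ i) (y≋y′ i)

  ·-congʳ : ∀ {n} (f : Point n) {x y : Point n} → x ≋ y → f · x ≈ f · y
  ·-congʳ f = ·-cong ≋-refl

  ·-comm : ∀ {n} (x y : Point n) → x · y ≈ y · x
  ·-comm x y = sum-cong-≋ λ i → *-comm (x i) (y i)

  ·-shiftʳ : ∀ {n} (f x : Point n) t u → f · shift x t u ≈ f · x + t * (f · u)
  ·-shiftʳ {n} f x t u = begin
    f · shift x t u
      ≈⟨ sum-cong-≋ (λ i → solve 4 (λ f x t u → f :* (x :+ t :* u) := f :* x :+ t :* (f :* u))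
                              refl (f i) (x i) t (u i)) ⟩
    ∑[ i < n ] (f i * x i + t * (f i * u i))
      ≈⟨ ∑-distrib-+ (λ i → f i * x i) (λ i → t * (f i * u i)) ⟩
    f · x + ∑[ i < n ] (t * (f i * u i))
      ≈⟨ +-congˡ (*-distribˡ-sum t (λ i → f i * u i)) ⟨
    f · x + t * (f · u) ∎

  ·-shiftˡ : ∀ {n} (f : Point n) t g x → shift f t g · x ≈ f · x + t * (g · x)
  ·-shiftˡ f t g x = begin
    shift f t g · x      ≈⟨ ·-comm (shift f t g) x ⟩
    x · shift f t g      ≈⟨ ·-shiftʳ x f t g ⟩
    x · f + t * (x · g)  ≈⟨ +-cong (·-comm x f) (*-congˡ (·-comm x g)) ⟩
    f · x + t * (g · x)  ∎

  ·-combination : ∀ {d n} (f : Point d) (c : Vector Carrier n) p →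
                  f · combination c p ≈ c · (λ i → f · p i)
  ·-combination {d} {n} f c p = begin
    ∑[ k < d ] (f k * ∑[ i < n ] (c i * p i k))
      ≈⟨ sum-cong-≋ (λ k → *-distribˡ-sum (f k) (λ i → c i * p i k)) ⟩
    ∑[ k < d ] ∑[ i < n ] (f k * (c i * p i k))
      ≈⟨ ∑-comm (λ k i → f k * (c i * p i k)) ⟩
    ∑[ i < n ] ∑[ k < d ] (f k * (c i * p i k))
      ≈⟨ sum-cong-≋ (λ i → sum-cong-≋ λ k →
           solve 3 (λ f c p → f :* (c :* p) := c :* (f :* p)) refl (f k) (c i) (p i k)) ⟩
    ∑[ i < n ] ∑[ k < d ] (c i * (f k * p i k))
      ≈⟨ sum-cong-≋ (λ i → *-distribˡ-sum (c i) (λ k → f k * p i k)) ⟨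
    c · (λ i → f · p i) ∎

  ·-zeroʳ : ∀ {n} (c : Vector Carrier n) {x} → (∀ i → x i ≈ 0#) → c · x ≈ 0#
  ·-zeroʳ c x≈0 = sum-zero λ i → trans (*-congˡ (x≈0 i)) (zeroʳ (c i))

  ·-negʳ : ∀ {n} (f x : Point n) → f · (λ k → - x k) ≈ - (f · x)
  ·-negʳ f x = begin
    f · (λ k → - x k)
      ≈⟨ ·-congʳ f (λ k → solve 1 (λ x → :- x := con (+ 0) :+ :- con (+ 1) :* x) refl (x k)) ⟩
    f · shift (λ _ → 0#) (- 1#) x
      ≈⟨ ·-shiftʳ f (λ _ → 0#) (- 1#) x ⟩
    f · (λ _ → 0#) + - 1# * (f · x)
      ≈⟨ +-congʳ (·-zeroʳ f (λ _ → refl)) ⟩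
    0# + - 1# * (f · x)
      ≈⟨ solve 1 (λ s → con (+ 0) :+ :- con (+ 1) :* s := :- s) refl (f · x) ⟩
    - (f · x) ∎

  ·-negˡ : ∀ {n} (f x : Point n) → (λ k → - f k) · x ≈ - (f · x)
  ·-negˡ f x = trans (·-comm _ x) (trans (·-negʳ x f) (-‿cong (·-comm x f)))

  ·-oneʳ : ∀ {n} (c : Vector Carrier n) → c · (λ _ → 1#) ≈ sum c
  ·-oneʳ c = sum-cong-≋ λ i → *-identityʳ (c i)

  unit : ∀ {n} → Fin n → Point n
  unit zero    = 1# ∷ λ _ → 0#
  unit (suc i) = 0# ∷ unit i

  unit-· : ∀ {n} i (x : Point n) → unit i · x ≈ x i
  unit-· zero    x = trans
    (+-cong (*-identityˡ _) (sum-zero {f = λ i → 0# * x (suc i)} λ i → zeroˡ (x (suc i))))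
    (+-identityʳ _)
  unit-· (suc i) x = trans (+-cong (zeroˡ _) (unit-· i (tail x))) (+-identityˡ _)

  unit-nonNegative : ∀ {n} (i j : Fin n) → 0# ≤ unit i j
  unit-nonNegative zero    zero    = 0≤1
  unit-nonNegative zero    (suc j) = ≤-refl
  unit-nonNegative (suc i) zero    = ≤-refl
  unit-nonNegative (suc i) (suc j) = unit-nonNegative i j

  self·-nonNegative : ∀ {n} (x : Point n) → 0# ≤ x · x
  self·-nonNegative x = sum-nonNegative λ i → square-nonNegative (x i)

  self·≈0⇒≈0 : ∀ {n} (x : Point n) → x · x ≈ 0# → ∀ i → x i ≈ 0#
  self·≈0⇒≈0 x x·x≈0 i = square≈0⇒≈0 (sum≈0⇒≈0 (λ i → square-nonNegative (x i)) x·x≈0 i)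

  combination-cong : ∀ {d n} {c c′ : Vector Carrier n} {p p′ : Vector (Point d) n} →
                     c ≋ c′ → (∀ i → p i ≋ p′ i) → combination c p ≋ combination c′ p′
  combination-cong c≋c′ p≋p′ k = sum-cong-≋ λ i → *-cong (c≋c′ i) (p≋p′ i k)

  combination-shift : ∀ {d n} (c : Vector Carrier n) t e (q : Vector (Point d) n) →
                      combination (shift c t e) q ≋ shift (combination c q) t (combination e q)
  combination-shift c t e q k = ·-shiftˡ c t e (λ i → q i k)

  combination-assoc : ∀ {d m n} (c : Vector Carrier m) (e : Matrix m n) (q : Vector (Point d) n) →
                      combination c (λ i → combination (e i) q) ≋ combination (combination c e) q
  combination-assoc c e q k = begin
    c · (λ i → e i · (λ j → q j k))         ≈⟨ sum-cong-≋ (λ i → *-congˡ (·-comm (e i) _)) ⟩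
    c · (λ i → (λ j → q j k) · e i)         ≈⟨ ·-combination (λ j → q j k) c e ⟨
    (λ j → q j k) · combination c e         ≈⟨ ·-comm (λ j → q j k) (combination c e) ⟩
    combination (combination c e) q k       ∎

  Span : ∀ {d n} → Vector (Point d) n → Point d → Set
  Span {n = n} q v = Σ (Vector Carrier n) λ c → v ≋ combination c q

  span-resp : ∀ {d n} {q : Vector (Point d) n} {v w} → v ≋ w → Span q v → Span q w
  span-resp v≋w (c , v≋cq) = c , ≋-trans (≋-sym v≋w) v≋cq

  span-combination : ∀ {d m n} {q : Vector (Point d) n} {p : Vector (Point d) m} →
                     (∀ i → Span q (p i)) → ∀ c → Span q (combination c p)
  span-combination {q = q} p∈ c =
    combination c (proj₁ ∘ p∈) ,
    ≋-trans (combination-cong ≋-refl (proj₂ ∘ p∈)) (combination-assoc c (proj₁ ∘ p∈) q)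

  span-trans : ∀ {d m n} {q : Vector (Point d) n} {p : Vector (Point d) m} {v} →
               (∀ i → Span q (p i)) → Span p v → Span q v
  span-trans p∈ (c , v≋cp) = span-resp (≋-sym v≋cp) (span-combination p∈ c)

  span-shift : ∀ {d n} {q : Vector (Point d) n} {v} t {u} → Span q v → Span q u → Span q (shift v t u)
  span-shift {q = q} t (c , v≋) (e , u≋) =
    shift c t e , λ k → trans (+-cong (v≋ k) (*-congˡ (u≋ k))) (sym (combination-shift c t e q k))

  span-tail : ∀ {d n} {q : Vector (Point d) (suc n)} {v} → Span (tail q) v → Span q v
  span-tail {q = q} (c , v≋) =
    0# ∷ c , λ k → trans (v≋ k) (sym (trans (+-congʳ (zeroˡ (q zero k))) (+-identityˡ _)))

  span-member : ∀ {d n} (q : Vector (Point d) n) i → Span q (q i)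
  span-member q i = unit i , λ k → sym (unit-· i (λ j → q j k))

  span-annihilated : ∀ {d n} {q : Vector (Point d) n} {v} (f : Point d) →
                     (∀ i → f · q i ≈ 0#) → Span q v → f · v ≈ 0#
  span-annihilated {q = q} f f·q≈0 (c , v≋) =
    trans (·-congʳ f v≋) (trans (·-combination f c q) (·-zeroʳ c f·q≈0))

  span-or-separated : ∀ {d n} (w : Vector (Point d) n) v →
                      Span w v ⊎ Σ (Point d) λ f → (∀ i → f · w i ≈ 0#) × ¬ (f · v ≈ 0#)
  span-or-separated {n = ℕ.zero} w v with em (v · v ≈ 0#)
  ... | yes v·v≈0 = inj₁ ([] , self·≈0⇒≈0 v v·v≈0)
  ... | no v·v≉0  = inj₂ (v , (λ ()) , v·v≉0)
  span-or-separated {n = ℕ.suc n} w v with span-or-separated (tail w) (head w)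
  ... | inj₁ w₀∈ with span-or-separated (tail w) v
  ...   | inj₁ v∈              = inj₁ (span-tail {q = w} v∈)
  ...   | inj₂ (f , f⊥ , f·v≉0) = inj₂ (f , (λ { zero → span-annihilated f f⊥ w₀∈ ; (suc i) → f⊥ i }) , f·v≉0)
  span-or-separated {n = ℕ.suc n} w v | inj₂ (g , g⊥ , g·w₀≉0)
    with span-or-separated (tail w) (shift v (- ((g · v) * (g · head w) ⁻¹)) (head w))
  ... | inj₁ v′∈ = inj₁ (span-resp {q = w}
          (λ k → solve 3 (λ v s w → v :+ :- s :* w :+ s :* w := v) refl (v k) _ (head w k))
          (span-shift {q = w} ((g · v) * (g · head w) ⁻¹) (span-tail {q = w} v′∈) (span-member w zero)))
  ... | inj₂ (h , h⊥ , h·v′≉0) = inj₂ (f , f⊥ , λ f·v≈0 → h·v′≉0 (trans (sym f·v≈h·v′) f·v≈0))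
    where
    w₀ = head w
    s = (h · w₀) * (g · w₀) ⁻¹
    f = shift h (- s) g

    f⊥ : ∀ i → f · w i ≈ 0#
    f⊥ zero = begin
      f · w₀                                        ≈⟨ ·-shiftˡ h (- s) g w₀ ⟩
      h · w₀ + - s * (g · w₀)
        ≈⟨ solve 3 (λ a b i → a :+ :- (a :* i) :* b := a :* (con (+ 1) :- b :* i))
                                                         refl (h · w₀) (g · w₀) ((g · w₀) ⁻¹) ⟩
      (h · w₀) * (1# - (g · w₀) * (g · w₀) ⁻¹)          ≈⟨ *-congˡ (+-congˡ (-‿cong (*-inverseʳ g·w₀≉0))) ⟩
      (h · w₀) * (1# - 1#)                            ≈⟨ *-congˡ (-‿inverseʳ 1#) ⟩
      (h · w₀) * 0#                                   ≈⟨ zeroʳ _ ⟩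
      0#                                            ∎
    f⊥ (suc i) = begin
      f · w (suc i)                         ≈⟨ ·-shiftˡ h (- s) g (w (suc i)) ⟩
      h · w (suc i) + - s * (g · w (suc i)) ≈⟨ +-cong (h⊥ i) (*-congˡ (g⊥ i)) ⟩
      0# + - s * 0#
        ≈⟨ solve 1 (λ s → con (+ 0) :+ s :* con (+ 0) := con (+ 0)) refl (- s) ⟩
      0#                                    ∎

    f·v≈h·v′ : f · v ≈ h · shift v (- ((g · v) * (g · w₀) ⁻¹)) w₀
    f·v≈h·v′ = begin
      f · v                                              ≈⟨ ·-shiftˡ h (- s) g v ⟩
      h · v + - ((h · w₀) * (g · w₀) ⁻¹) * (g · v)
        ≈⟨ solve 4 (λ a b c i → a :+ :- (b :* i) :* c := a :+ :- (c :* i) :* b)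
                                                              refl (h · v) (h · w₀) (g · v) ((g · w₀) ⁻¹) ⟩
      h · v + - ((g · v) * (g · w₀) ⁻¹) * (h · w₀)         ≈⟨ ·-shiftʳ h v _ w₀ ⟨
      h · shift v (- ((g · v) * (g · w₀) ⁻¹)) w₀           ∎

  LinearlyIndependent : ∀ {d n} → Vector (Point d) n → Set
  LinearlyIndependent q = ∀ c → (∀ k → combination c q k ≈ 0#) → ∀ i → c i ≈ 0#

  independent-∷ : ∀ {d n} {q : Vector (Point d) (suc n)} →
                  LinearlyIndependent (tail q) → ¬ Span (tail q) (head q) → LinearlyIndependent q
  independent-∷ {q = q} indep v∉ c cq≈0 with em (c zero ≈ 0#)
  ... | yes c₀≈0 = λ where
    zero    → c₀≈0
    (suc i) → indep (tail c) (λ k → trans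
      (solve 2 (λ a b → b := con (+ 0) :* a :+ b) refl (head q k) _)
      (trans (+-congʳ (*-congʳ (sym c₀≈0))) (cq≈0 k))) i
  ... | no c₀≉0 = contradiction
    (span-resp v≋ (span-combination (span-member (tail q)) (λ i → - c zero ⁻¹ * c (suc i)))) v∉
    where
    v≋ : combination (λ i → - c zero ⁻¹ * c (suc i)) (tail q) ≋ head q
    v≋ k = begin
      (λ i → - c zero ⁻¹ * c (suc i)) · (λ i → tail q i k)
        ≈⟨ sum-cong-≋ (λ i → *-assoc (- c zero ⁻¹) (c (suc i)) (tail q i k)) ⟩
      _
        ≈⟨ *-distribˡ-sum (- c zero ⁻¹) (λ i → c (suc i) * tail q i k) ⟨
      - c zero ⁻¹ * combination (tail c) (tail q) k
        ≈⟨ solve 4 (λ a i v r → :- i :* r := a :* i :* v :- i :* (a :* v :+ r))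
             refl (c zero) (c zero ⁻¹) (head q k) (combination (tail c) (tail q) k) ⟩
      c zero * c zero ⁻¹ * head q k - c zero ⁻¹ * (c zero * head q k + combination (tail c) (tail q) k)
        ≈⟨ +-cong (*-congʳ (*-inverseʳ c₀≉0)) (-‿cong (*-congˡ (cq≈0 k))) ⟩
      1# * head q k - c zero ⁻¹ * 0#
        ≈⟨ solve 2 (λ v i → con (+ 1) :* v :- i :* con (+ 0) := v) refl (head q k) (c zero ⁻¹) ⟩
      head q k ∎

  -- Greedy choice from the last index to the first: an index enters when `T` holds there and its
  -- vector is outside the span of those already chosen.
  independent-subfamily : ∀ {d n} (h : Vector (Point d) n) (T : Fin n → Set) →
    ∃[ m ] Σ (Fin m → Fin n) λ ι →
      LinearlyIndependent (h ∘ ι) × (∀ i → T (ι i)) × (∀ j → T j → Span (h ∘ ι) (h j))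
  independent-subfamily {n = ℕ.zero}  h T = 0 , (λ ()) , (λ _ _ ()) , (λ ()) , λ ()
  independent-subfamily {n = ℕ.suc n} h T with independent-subfamily (tail h) (T ∘ suc)
  ... | m , ι , indep , T∘ι , spans with em (T zero × ¬ Span (tail h ∘ ι) (head h))
  ...   | yes (T₀ , h₀∉) =
          suc m , ι⁺ , independent-∷ {q = h ∘ ι⁺} indep h₀∉ , (λ { zero → T₀ ; (suc i) → T∘ι i }) ,
          λ { zero _ → span-member (h ∘ ι⁺) zero ; (suc j) Tj → span-tail {q = h ∘ ι⁺} (spans j Tj) }
    where ι⁺ = zero ∷ (suc ∘ ι)
  ...   | no ¬T₀ =
          m , suc ∘ ι , indep , T∘ι ,
          λ { zero T₀ → decidable-stable (em _) (λ h₀∉ → ¬T₀ (T₀ , h₀∉)) ; (suc j) Tj → spans j Tj }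

  -- Gaussian elimination on the first column: a row with nonzero entry there is the pivot, the
  -- other rows are reduced by it, and a relation among the reduced rows is extended to the pivot.
  nontrivial-relation : ∀ {m n} (M : Matrix m n) → n ℕ.< m →
    Σ (Vector Carrier m) λ c → (∃[ i ] ¬ (c i ≈ 0#)) × (∀ k → combination c M k ≈ 0#)
  nontrivial-relation {suc m} {ℕ.zero} M _ = (λ _ → 1#) , (zero , 1≉0) , λ ()
  nontrivial-relation {suc m} {suc n} M (ℕ.s≤s n<m) with em (∃[ i ] ¬ (M i zero ≈ 0#))
  ... | no M₀≈0 = let c , c≉0 , cM≈0 = nontrivial-relation (tail ∘ M) (ℕ.m<n⇒m<1+n n<m) in
    c , c≉0 , λ where
      zero    → ·-zeroʳ c λ i → decidable-stable (em _) λ Mi≉0 → M₀≈0 (i , Mi≉0)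
      (suc k) → cM≈0 k
  ... | yes (i , Mi≉0) with nontrivial-relation (tail ∘ N) n<m
    where
    N : Matrix m (suc n)
    N j = shift (removeAt M i j) (- (removeAt M i j zero * M i zero ⁻¹)) (M i)
  ...   | c , (j , cj≉0) , cN≈0 =
    c′ , (punchIn i j , λ cj≈0 → cj≉0 (trans (reflexive (≡.sym (insertAt-punchIn c i s j))) cj≈0)) , c′M≈0
    where
    r = λ j → - (removeAt M i j zero * M i zero ⁻¹)
    N = λ j → shift (removeAt M i j) (r j) (M i)
    -- Row j was reduced by adding `r j` times the pivot row, so the pivot row occurs in the
    -- relation with total weight `c · r`.
    s = c · r
    c′ = insertAt c i s

    c′M≈cN : ∀ k → combination c′ M k ≈ combination c N k
    c′M≈cN k = begin
      combination c′ M k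
        ≈⟨ sum-remove {i = i} (λ j → c′ j * M j k) ⟩
      c′ i * M i k + ∑[ j < m ] (c′ (punchIn i j) * removeAt M i j k)
        ≈⟨ +-cong (*-congʳ (reflexive (insertAt-lookup c i s)))
             (sum-cong-≋ λ j → *-congʳ (reflexive (insertAt-punchIn c i s j))) ⟩
      (c · r) * M i k + c · (λ j → removeAt M i j k)
        ≈⟨ trans (+-comm _ _) (+-congˡ (trans (*-comm _ _) (*-congˡ (·-comm c r)))) ⟩
      c · (λ j → removeAt M i j k) + M i k * (r · c)
        ≈⟨ +-congˡ (*-congˡ (·-comm r c)) ⟩
      c · (λ j → removeAt M i j k) + M i k * (c · r)
        ≈⟨ ·-shiftʳ c (λ j → removeAt M i j k) (M i k) r ⟨
      c · shift (λ j → removeAt M i j k) (M i k) r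
        ≈⟨ ·-congʳ c (λ j → +-congˡ (*-comm (M i k) (r j))) ⟩
      combination c N k ∎

    c′M≈0 : ∀ k → combination c′ M k ≈ 0#
    c′M≈0 (suc k) = trans (c′M≈cN (suc k)) (cN≈0 k)
    c′M≈0 zero    = trans (c′M≈cN zero) (·-zeroʳ c λ j → begin
      removeAt M i j zero + - (removeAt M i j zero * M i zero ⁻¹) * M i zero
        ≈⟨ solve 3 (λ a b i → a :+ :- (a :* i) :* b := a :* (con (+ 1) :- b :* i))
             refl (removeAt M i j zero) (M i zero) (M i zero ⁻¹) ⟩
      removeAt M i j zero * (1# - M i zero * M i zero ⁻¹)
        ≈⟨ *-congˡ (trans (+-congˡ (-‿cong (*-inverseʳ Mi≉0))) (-‿inverseʳ 1#)) ⟩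
      removeAt M i j zero * 0#
        ≈⟨ zeroʳ _ ⟩
      0# ∎)

  -- With more vectors than generators the coefficient rows satisfy a nontrivial relation, and the
  -- vectors inherit it.
  independent-in-span : ∀ {d m n} {w : Vector (Point d) m} {p : Vector (Point d) n} →
                        LinearlyIndependent w → (∀ i → Span p (w i)) → m ℕ.≤ n
  independent-in-span {w = w} {p} indep w∈ = ℕ.≮⇒≥ λ n<m →
    let c , (i , ci≉0) , cM≈0 = nontrivial-relation (proj₁ ∘ w∈) n<m in
    ci≉0 (indep c (λ k → begin
      combination c w k                                    ≈⟨ combination-cong ≋-refl (proj₂ ∘ w∈) k ⟩
      combination c (λ i → combination (proj₁ (w∈ i)) p) k  ≈⟨ combination-assoc c (proj₁ ∘ w∈) p k ⟩
      combination (combination c (proj₁ ∘ w∈)) p k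
        ≈⟨ sum-zero (λ j → trans (*-congʳ (cM≈0 j)) (zeroˡ _)) ⟩
      0#                                                    ∎) i)

-- Induction on tight sets and the ratio test

module Tightness (ℝ : RealField) where

  open RealField ℝ hiding (zero)
  open IntegerSolver ℝ
  open RealProperties ℝ
  open Relation.Binary.Reasoning.Setoid setoid

  private
    toSubset : ∀ {n} → (Fin n → Set) → Subset n
    toSubset T = tabulate λ j → does (em (T j))

    ∈-toSubset⁺ : ∀ {n} {T : Fin n → Set} {j} → T j → j ∈ˢ toSubset T
    ∈-toSubset⁺ {T = T} {j} Tj = lookup⇒[]= j _ (≡.trans (lookup∘tabulate _ j) does≡true)
      where
      does≡true : does (em (T j)) ≡ inside
      does≡true with em (T j)
      ... | yes _  = ≡.refl
      ... | no ¬Tj = contradiction Tj ¬Tj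

    ∈-toSubset⁻ : ∀ {n} {T : Fin n → Set} {j} → j ∈ˢ toSubset T → T j
    ∈-toSubset⁻ {T = T} {j} j∈
      with em (T j) | ≡.trans (≡.sym (lookup∘tabulate (λ j → does (em (T j))) j)) ([]=⇒lookup j∈)
    ... | yes Tj | _ = Tj

  -- The tight set grows strictly from `a` to `b` and has at most n elements. Excluded middle turns
  -- the predicate `T a` into a `Subset`, on which strict inclusion is well founded in the growing
  -- direction.
  tightness-induction : ∀ {n} {A : Set} (T : A → Fin n → Set) (P : A → Set) →
    (∀ a → (∀ b → (∀ j → T a j → T b j) → (∃[ j ] T b j × ¬ T a j) → P b) → P a) → ∀ a → P a
  tightness-induction {n} T P step a = go a (⊃-wellFounded (toSubset (T a)))
    where
    go : ∀ a → Acc _⊃_ (toSubset (T a)) → P a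
    go a (acc rs) = step a λ b Ta⊆Tb (j , Tbj , ¬Taj) →
      go b (rs ( (λ i∈ → ∈-toSubset⁺ {T = T b} (Ta⊆Tb _ (∈-toSubset⁻ {T = T a} i∈)))
               , j , ∈-toSubset⁺ {T = T b} Tbj , λ j∈ → ¬Taj (∈-toSubset⁻ {T = T a} j∈)))

  argmin : ∀ {n} (g : Vector Carrier n) (Q : Fin n → Set) →
           (∃[ j ] Q j × (∀ i → Q i → g j ≤ g i)) ⊎ (∀ j → ¬ Q j)
  argmin {ℕ.zero}  g Q = inj₂ λ ()
  argmin {ℕ.suc n} g Q with em (Q zero) | argmin (tail g) (Q ∘ suc)
  ... | no ¬Q₀ | inj₂ ¬Q = inj₂ λ { zero → ¬Q₀ ; (suc j) → ¬Q j }
  ... | no ¬Q₀ | inj₁ (j , Qj , min) =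
          inj₁ (suc j , Qj , λ { zero Q₀ → contradiction Q₀ ¬Q₀ ; (suc i) → min i })
  ... | yes Q₀ | inj₂ ¬Q =
          inj₁ (zero , Q₀ , λ { zero _ → ≤-refl ; (suc i) Qi → contradiction Qi (¬Q i) })
  ... | yes Q₀ | inj₁ (j , Qj , min) with total (g zero) (g (suc j))
  ...   | inj₁ g₀≤ = inj₁ (zero , Q₀ , λ { zero _ → ≤-refl ; (suc i) Qi → ≤-trans g₀≤ (min i Qi) })
  ...   | inj₂ ≤g₀ = inj₁ (suc j , Qj , λ { zero _ → ≤g₀ ; (suc i) → min i })

  -- As in the simplex method, t is the least ratio `α j` / (- `δ j`) over the j with negative
  -- `δ j`. The minimising entry reaches zero, the other decreasing ones are not past zero yet, and
  -- the rest never decrease.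
  ratio-test : ∀ {n} (α δ : Vector Carrier n) → (∀ j → 0# ≤ α j) → (∃[ j ] ¬ (0# ≤ δ j)) →
    ∃[ t ] 0# ≤ t × (∀ j → 0# ≤ α j + t * δ j) × (∃[ j ] ¬ (0# ≤ δ j) × α j + t * δ j ≈ 0#)
  ratio-test α δ 0≤α (i₀ , δ≱0) with argmin (λ j → α j * (- δ j) ⁻¹) (λ j → ¬ (0# ≤ δ j))
  ... | inj₂ none = contradiction δ≱0 (none i₀)
  ... | inj₁ (j , 0≰δj , min) =
    t , *-nonNegative (0≤α j) (⁻¹-nonNegative (0≤-δ 0≰δj)) , nonNegative , j , 0≰δj , (begin
      α j + α j * (- δ j) ⁻¹ * δ j
        ≈⟨ solve 3 (λ a d i → a :+ a :* i :* d := a :* (con (+ 1) :- :- d :* i))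
                                               refl (α j) (δ j) ((- δ j) ⁻¹) ⟩
      α j * (1# - - δ j * (- δ j) ⁻¹)     ≈⟨ *-congˡ (+-congˡ (-‿cong (*-inverseʳ (-δ≉0 0≰δj)))) ⟩
      α j * (1# - 1#)                     ≈⟨ *-congˡ (-‿inverseʳ 1#) ⟩
      α j * 0#                            ≈⟨ zeroʳ (α j) ⟩
      0#                                  ∎)
    where
    t = α j * (- δ j) ⁻¹

    0≤-δ : ∀ {d} → ¬ (0# ≤ d) → 0# ≤ - d
    0≤-δ 0≰d = neg-nonNegative (≰⇒≥ 0≰d)

    -δ≉0 : ∀ {d} → ¬ (0# ≤ d) → ¬ (- d ≈ 0#)
    -δ≉0 {d} 0≰d -d≈0 = 0≰d (≤-reflexive (sym (begin
      d      ≈⟨ solve 1 (λ d → d := :- :- d) refl d ⟩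
      - - d  ≈⟨ -‿cong -d≈0 ⟩
      - 0#   ≈⟨ -0#≈0# ⟩
      0#     ∎)))

    nonNegative : ∀ i → 0# ≤ α i + t * δ i
    nonNegative i with em (0# ≤ δ i)
    ... | yes 0≤δi = +-nonNegative (0≤α i)
                       (*-nonNegative (*-nonNegative (0≤α j) (⁻¹-nonNegative (0≤-δ 0≰δj))) 0≤δi)
    ... | no 0≰δi  = ≤-respʳ
      (begin
        - δ i * (α i * (- δ i) ⁻¹) - - δ i * t
          ≈⟨ solve 4 (λ a d i t → :- d :* (a :* i) :- :- d :* t := a :* (:- d :* i) :+ t :* d)
                                                     refl (α i) (δ i) ((- δ i) ⁻¹) t ⟩
        α i * (- δ i * (- δ i) ⁻¹) + t * δ i    ≈⟨ +-congʳ (*-congˡ (*-inverseʳ (-δ≉0 0≰δi))) ⟩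
        α i * 1# + t * δ i                      ≈⟨ +-congʳ (*-identityʳ (α i)) ⟩
        α i + t * δ i                           ∎)
      (x≤y⇒0≤y-x (*-monoˡ-≤-nonNeg (- δ i) (0≤-δ 0≰δi) (min i 0≰δi)))

  indicator : Set → Carrier
  indicator A with em A
  ... | yes _ = 1#
  ... | no _  = 0#

  indicator-nonNegative : ∀ A → 0# ≤ indicator A
  indicator-nonNegative A with em A
  ... | yes _ = 0≤1
  ... | no _  = ≤-refl

  indicator-true : ∀ {A} → A → indicator A ≈ 1#
  indicator-true {A} a with em A
  ... | yes _ = refl
  ... | no ¬a = contradiction a ¬a

  indicator-*-cong : ∀ A {x y} → (A → x ≈ y) → indicator A * x ≈ indicator A * y
  indicator-*-cong A x≈y with em A
  ... | yes a = *-congˡ (x≈y a)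
  ... | no _  = trans (zeroˡ _) (sym (zeroˡ _))

-- Points of a polytope and its vertices

module Vertices (ℝ : RealField) where

  open RealField ℝ hiding (zero)
  open Polytopes ℝ
  open IntegerSolver ℝ
  open RealProperties ℝ
  open LinearAlgebra ℝ
  open Tightness ℝ
  open Algebra.Properties.Semiring.Sum semiring
  open Data.Vec.Functional.Relation.Binary.Equality.Setoid setoid using (_≋_; ≋-refl; ≋-sym; ≋-trans)
  open Relation.Binary.Reasoning.Setoid setoid

  ∈⇒∈Aff : ∀ {d} {X : PointSet d} {x} → x ∈ X → x ∈ Aff X
  ∈⇒∈Aff {x = x} x∈X = 1 , (λ _ → x) , (λ _ → 1#) , (λ _ → x∈X) , +-identityʳ 1# ,
    λ k → sym (trans (+-identityʳ _) (*-identityˡ (x k)))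

  Aff-mono : ∀ {d} {X Y : PointSet d} → X ⊆ Y → Aff X ⊆ Aff Y
  Aff-mono X⊆Y (n , p , c , p∈X , Σc≈1 , x≋) = n , p , c , (λ i → X⊆Y (p∈X i)) , Σc≈1 , x≋

  singleton-dim : ∀ {d} {X : PointSet d} {x} → x ∈ X → (∀ {y} → y ∈ X → y ≋ x) → HasDim X (+ 0)
  singleton-dim {X = X} {x} x∈X unique =
    1 , ≡.refl , (λ _ → x) , (λ _ → ∈⇒∈Aff x∈X) ,
    (λ { c Σc≈0 _ zero → trans (sym (+-identityʳ _)) Σc≈0 }) ,
    Aff-mono {X = X} (λ y∈X → zero , unique y∈X)

  bounded : ∀ {n} (g : Vector Carrier n) → ∃[ B ] ∀ j → g j ≤ B
  bounded {ℕ.zero}  g = 0# , λ ()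
  bounded {ℕ.suc n} g with bounded (tail g)
  ... | B , g≤B with total (g zero) B
  ...   | inj₁ g₀≤B = B , λ { zero → g₀≤B ; (suc j) → g≤B j }
  ...   | inj₂ B≤g₀ = g zero , λ { zero → ≤-refl ; (suc j) → ≤-trans (g≤B j) B≤g₀ }

  module _ {d} (P : Polytope d) where

    open Polytope P

    functional-bounded : ∀ f → ∃[ B ] ∀ {x} → x ∈ points → f · x ≤ B
    functional-bounded f with bounded (λ j → f · V j)
    ... | B , f·V≤B = B , λ x∈P → let c , 0≤c , Σc≈1 , x≋ = proj₁ description x∈P in
      ≤-resp-≈
        (sym (trans (·-congʳ f x≋) (·-combination f c V)))
        (begin
          ∑[ j < n ] (c j * B)  ≈⟨ *-distribʳ-sum B c ⟨
          sum c * B             ≈⟨ *-congʳ Σc≈1 ⟩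
          1# * B                ≈⟨ *-identityˡ B ⟩
          B                     ∎)
        (sum-mono-≤ λ j → *-monoˡ-≤-nonNeg (c j) (0≤c j) (f·V≤B j))

    slackAt : Point d → Vector Carrier m
    slackAt x i = b i - A i · x

    slackAt-shift : ∀ x t u i → slackAt (shift x t u) i ≈ slackAt x i + t * - (A i · u)
    slackAt-shift x t u i = trans (+-congˡ (-‿cong (·-shiftʳ (A i) x t u)))
      (solve 4 (λ b a t u → b :- (a :+ t :* u) := b :- a :+ t :* :- u) refl (b i) (A i · x) t (A i · u))

    Tight : Point d → Fin m → Set
    Tight x i = slackAt x i ≈ 0#

    -- Otherwise the whole ray from x in direction u stays in P. Along it the functional u grows at
    -- rate `u · u`, which is positive, while on the convex hull of `V` it is bounded.
    leaves : ∀ {x} → x ∈ points → ∀ u → ¬ (∀ k → u k ≈ 0#) → ∃[ i ] ¬ (0# ≤ - (A i · u))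
    leaves {x} x∈P u u≉0 with em (∃[ i ] ¬ (0# ≤ - (A i · u)))
    ... | yes leaving = leaving
    ... | no stays with functional-bounded u
    ...   | B , bound = contradiction
      (≤-resp-≈
        (begin
          u · shift x t u - (B - (B - u · x))                ≈⟨ +-congʳ (·-shiftʳ u x t u) ⟩
          u · x + t * (u · u) - (B - (B - u · x))            ≈⟨ solve 4 (λ a b n i →
            a :+ (b :- a :+ con (+ 1)) :* i :* n :- (b :- (b :- a)) := (b :- a :+ con (+ 1)) :* (n :* i))
            refl (u · x) B (u · u) ((u · u) ⁻¹) ⟩
          (B - u · x + 1#) * ((u · u) * (u · u) ⁻¹)
            ≈⟨ *-congˡ (*-inverseʳ (λ u·u≈0 → u≉0 (self·≈0⇒≈0 u u·u≈0))) ⟩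
          (B - u · x + 1#) * 1#
            ≈⟨ solve 2 (λ a b → (b :- a :+ con (+ 1)) :* con (+ 1) := con (+ 1) :+ (b :- a)) refl (u · x) B ⟩
          1# + (B - u · x)                                   ∎)
        (solve 2 (λ a b → b :- (b :- (b :- a)) := b :- a) refl (u · x) B)
        (+-monoˡ-≤ (- (B - (B - u · x))) (bound shift∈P)))
      (λ 1+y≤y → 1≰0 (≤-resp-≈
        (solve 1 (λ y → con (+ 1) :+ y :- y := con (+ 1)) refl (B - u · x))
        (-‿inverseʳ (B - u · x)) (+-monoˡ-≤ (- (B - u · x)) 1+y≤y)))
      where
      -- Chosen so that `u · shift x t u` is B + 1, just beyond the bound.
      t = (B - u · x + 1#) * (u · u) ⁻¹

      0≤t : 0# ≤ t
      0≤t = *-nonNegative (+-nonNegative (x≤y⇒0≤y-x (bound x∈P)) 0≤1) (⁻¹-nonNegative (self·-nonNegative u))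

      shift∈P : shift x t u ∈ points
      shift∈P i = 0≤y-x⇒x≤y (≤-respʳ (sym (slackAt-shift x t u i))
        (+-nonNegative (x≤y⇒0≤y-x (x∈P i))
          (*-nonNegative 0≤t (decidable-stable (em _) λ ≰ → stays (i , ≰)))))

    -- The ratio test applied to the slacks along the ray. Its blocking inequality has strictly
    -- decreasing slack, whereas u keeps the slacks tight at x constant; so the blocking one is
    -- newly tight, and reaching it takes a nonzero t.
    tighten : ∀ {x} → x ∈ points → ∀ u → ¬ (∀ k → u k ≈ 0#) → (∀ i → Tight x i → A i · u ≈ 0#) →
      ∃[ t ] 0# ≤ t × ¬ (t ≈ 0#) × shift x t u ∈ points ×
        (∀ i → Tight x i → Tight (shift x t u) i) × (∃[ i ] Tight (shift x t u) i × ¬ Tight x i)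
    tighten {x} x∈P u u≉0 tight⇒
      with ratio-test (slackAt x) (λ i → - (A i · u)) (λ i → x≤y⇒0≤y-x (x∈P i)) (leaves x∈P u u≉0)
    ... | t , 0≤t , 0≤α+tδ , i , 0≰δi , α+tδ≈0 =
      t , 0≤t , t≉0 ,
      (λ j → 0≤y-x⇒x≤y (≤-respʳ (sym (slackAt-shift x t u j)) (0≤α+tδ j))) ,
      (λ j x-tight → begin
        slackAt (shift x t u) j         ≈⟨ slackAt-shift x t u j ⟩
        slackAt x j + t * - (A j · u)   ≈⟨ +-cong x-tight (*-congˡ (-‿cong (tight⇒ j x-tight))) ⟩
        0# + t * - 0#
          ≈⟨ solve 1 (λ t → con (+ 0) :+ t :* :- con (+ 0) := con (+ 0)) refl t ⟩
        0#                              ∎) ,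
      i , trans (slackAt-shift x t u i) α+tδ≈0 , ¬tight
      where
      ¬tight : ¬ Tight x i
      ¬tight x-tight = 0≰δi (≤-reflexive (sym (trans (-‿cong (tight⇒ i x-tight)) -0#≈0#)))

      t≉0 : ¬ (t ≈ 0#)
      t≉0 t≈0 = ¬tight (begin
        slackAt x i
          ≈⟨ solve 2 (λ s d → s := s :+ con (+ 0) :* d) refl (slackAt x i) (- (A i · u)) ⟩
        slackAt x i + 0# * - (A i · u)   ≈⟨ +-congˡ (*-congʳ t≈0) ⟨
        slackAt x i + t * - (A i · u)    ≈⟨ α+tδ≈0 ⟩
        0#                               ∎)

    -- The sum of the tight inequalities exposes x.
    determined⇒vertex : ∀ {x} → x ∈ points →
      (∀ u → (∀ i → Tight x i → A i · u ≈ 0#) → ∀ k → u k ≈ 0#) → IsVertex points x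
    determined⇒vertex {x} x∈P determined =
      a , β , valid , singleton-dim {X = Face points a β} x∈Face (λ (y∈P , a·y≈β) → face⇒≋ y∈P a·y≈β) , x∈Face
      where
      w : Vector Carrier m
      w i = indicator (Tight x i)

      a = combination w A
      β = w · b

      a·≈ : ∀ y → a · y ≈ w · (λ i → A i · y)
      a·≈ y = trans (·-comm a y) (trans (·-combination y w A) (·-congʳ w λ i → ·-comm y (A i)))

      valid : Valid points a β
      valid {y} y∈P = ≤-resp-≈ (sym (a·≈ y)) refl
        (sum-mono-≤ λ i → *-monoˡ-≤-nonNeg (w i) (indicator-nonNegative _) (y∈P i))

      x∈Face : x ∈ Face points a β
      x∈Face = x∈P , trans (a·≈ x) (sum-cong-≋ λ i → indicator-*-cong (Tight x i) λ x-tight → begin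
        A i · x                ≈⟨ solve 2 (λ a b → a := b :- (b :- a)) refl (A i · x) (b i) ⟩
        b i - slackAt x i      ≈⟨ +-congˡ (-‿cong x-tight) ⟩
        b i - 0#               ≈⟨ solve 1 (λ b → b :- con (+ 0) := b) refl (b i) ⟩
        b i                    ∎)

      face⇒tight : ∀ {y} → y ∈ points → a · y ≈ β → ∀ i → Tight x i → Tight y i
      face⇒tight {y} y∈P a·y≈β i x-tight = begin
        slackAt y i          ≈⟨ *-identityˡ _ ⟨
        1# * slackAt y i     ≈⟨ *-congʳ (indicator-true x-tight) ⟨
        w i * slackAt y i
          ≈⟨ sum≈0⇒≈0 (λ j → *-nonNegative (indicator-nonNegative _) (x≤y⇒0≤y-x (y∈P j))) w·slack≈0 i ⟩
        0#                   ∎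
        where
        w·slack≈0 : w · slackAt y ≈ 0#
        w·slack≈0 = begin
          w · slackAt y
            ≈⟨ ·-congʳ w (λ j → solve 2 (λ b a → b :- a := b :+ :- con (+ 1) :* a) refl (b j) (A j · y)) ⟩
          w · shift b (- 1#) (λ j → A j · y)              ≈⟨ ·-shiftʳ w b (- 1#) (λ j → A j · y) ⟩
          w · b + - 1# * (w · (λ j → A j · y))            ≈⟨ +-congˡ (*-congˡ (trans (sym (a·≈ y)) a·y≈β)) ⟩
          β + - 1# * β
            ≈⟨ solve 1 (λ b → b :+ :- con (+ 1) :* b := con (+ 0)) refl β ⟩
          0#                                              ∎

      face⇒≋ : ∀ {y} → y ∈ points → a · y ≈ β → y ≋ x
      face⇒≋ {y} y∈P a·y≈β k = begin
        y k
          ≈⟨ solve 2 (λ y x → y := (y :+ :- con (+ 1) :* x) :+ x) refl (y k) (x k) ⟩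
        shift y (- 1#) x k + x k   ≈⟨ +-congʳ (determined (shift y (- 1#) x) u⊥ k) ⟩
        0# + x k                   ≈⟨ +-identityˡ (x k) ⟩
        x k                        ∎
        where
        u⊥ : ∀ i → Tight x i → A i · shift y (- 1#) x ≈ 0#
        u⊥ i x-tight = begin
          A i · shift y (- 1#) x             ≈⟨ ·-shiftʳ (A i) y (- 1#) x ⟩
          A i · y + - 1# * (A i · x)
            ≈⟨ solve 3 (λ y x b → y :+ :- con (+ 1) :* x := (b :- x) :- (b :- y))
                                                  refl (A i · y) (A i · x) (b i) ⟩
          slackAt x i - slackAt y i          ≈⟨ +-cong x-tight (-‿cong (face⇒tight y∈P a·y≈β i x-tight)) ⟩
          0# - 0#                            ≈⟨ -‿inverseʳ 0# ⟩
          0#                                 ∎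

    -- A nonzero direction u orthogonal to all tight normals gives the two endpoints, by `tighten`
    -- along u and along its negative. If there is none, the tight equations determine x, and
    -- `determined⇒vertex` applies.
    vertex-induction : (Q : Point d → Set) →
      (∀ {x y} → x ≋ y → Q x → Q y) →
      (∀ {x y} s t → 0# ≤ s → 0# ≤ t → s + t ≈ 1# → Q x → Q y → Q (shift (λ k → s * x k) t y)) →
      (∀ {v} → IsVertex points v → Q v) →
      ∀ {x} → x ∈ points → Q x
    vertex-induction Q Q-resp Q-convex Q-vertex {x₀} x₀∈P =
      tightness-induction (λ (a : ∃ points) → Tight (proj₁ a)) (λ a → Q (proj₁ a))
        (λ (x , x∈P) → step x x∈P) (x₀ , x₀∈P)
      where
      between : ∀ {x u s t} → 0# ≤ s → ¬ (s ≈ 0#) → 0# ≤ t →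
                Q (shift x s u) → Q (shift x t (λ k → - u k)) → Q x
      between {x} {u} {s} {t} 0≤s s≉0 0≤t Qx₊ Qx₋ =
        -- The weights are crossed: the endpoint at distance s gets t / (s + t) and the one at
        -- distance t gets s / (s + t), so the displacements cancel.
        Q-resp x≋ (Q-convex (t * r) (s * r) (*-nonNegative 0≤t 0≤r) (*-nonNegative 0≤s 0≤r) weights≈1 Qx₊ Qx₋)
        where
        r = (s + t) ⁻¹

        0≤r : 0# ≤ r
        0≤r = ⁻¹-nonNegative (+-nonNegative 0≤s 0≤t)

        s+t≉0 : ¬ (s + t ≈ 0#)
        s+t≉0 s+t≈0 = s≉0 (antisym (≤-resp-≈ (+-identityʳ s) s+t≈0 (+-mono-≤ ≤-refl 0≤t)) 0≤s)

        weights≈1 : t * r + s * r ≈ 1#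
        weights≈1 = trans (solve 3 (λ s t r → t :* r :+ s :* r := (s :+ t) :* r) refl s t r) (*-inverseʳ s+t≉0)

        x≋ : shift (λ k → t * r * shift x s u k) (s * r) (shift x t (λ k → - u k)) ≋ x
        x≋ k = begin
          t * r * (x k + s * u k) + s * r * (x k + t * - u k)
            ≈⟨ solve 5 (λ x u s t r → t :* r :* (x :+ s :* u) :+ s :* r :* (x :+ t :* :- u) := (s :+ t) :* r :* x)
                 refl (x k) (u k) s t r ⟩
          (s + t) * r * x k   ≈⟨ *-congʳ (*-inverseʳ s+t≉0) ⟩
          1# * x k            ≈⟨ *-identityˡ (x k) ⟩
          x k                 ∎

      step : ∀ x (x∈P : x ∈ points) →
        (∀ b → (∀ j → Tight x j → Tight (proj₁ b) j) → (∃[ j ] Tight (proj₁ b) j × ¬ Tight x j) → Q (proj₁ b)) →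
        Q x
      step x x∈P rec = decide (em _)
        where
        Movable : Point d → Set
        Movable u = ¬ (∀ k → u k ≈ 0#) × (∀ i → Tight x i → A i · u ≈ 0#)

        negated : ∀ {u} → Movable u → Movable (λ k → - u k)
        negated {u} (u≉0 , u⊥) =
          (λ -u≈0 → u≉0 λ k → begin
            u k       ≈⟨ solve 1 (λ u → u := :- :- u) refl (u k) ⟩
            - - u k   ≈⟨ -‿cong (-u≈0 k) ⟩
            - 0#      ≈⟨ -0#≈0# ⟩
            0#        ∎) ,
          λ i x-tight → trans (·-negʳ (A i) u) (trans (-‿cong (u⊥ i x-tight)) -0#≈0#)

        decide : Dec (∃ Movable) → Q x
        decide (no determined) = Q-vertex (determined⇒vertex x∈P λ u u⊥ →
          decidable-stable (em _) λ u≉0 → determined (u , u≉0 , u⊥))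
        decide (yes (u , movable)) =
          let (-u≉0 , -u⊥) = negated movable
              (s , 0≤s , s≉0 , x₊∈P , x₊-tight , x₊-new) = tighten x∈P u (proj₁ movable) (proj₂ movable)
              (t , 0≤t , _ , x₋∈P , x₋-tight , x₋-new) = tighten x∈P (λ k → - u k) -u≉0 -u⊥
          in between 0≤s s≉0 0≤t (rec (shift x s u , x₊∈P) x₊-tight x₊-new)
                                 (rec (shift x t (λ k → - u k) , x₋∈P) x₋-tight x₋-new)

-- Facets and the sufficiency of their inequalities

module Facets (ℝ : RealField) where

  open RealField ℝ hiding (zero)
  open Polytopes ℝ
  open IntegerSolver ℝ
  open RealProperties ℝ
  open LinearAlgebra ℝ
  open Tightness ℝ
  open Vertices ℝ
  open Algebra.Properties.Semiring.Sum semiring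
  open Data.Vec.Functional.Relation.Binary.Equality.Setoid setoid using (_≋_; ≋-refl; ≋-sym; ≋-trans)
  open Relation.Binary.Reasoning.Setoid setoid

  -- Homogenisation turns affine notions into linear ones.
  hat : ∀ {d} → Point d → Point (suc d)
  hat x = 1# ∷ x

  hat-cong : ∀ {d} {x y : Point d} → x ≋ y → hat x ≋ hat y
  hat-cong x≋y zero    = refl
  hat-cong x≋y (suc k) = x≋y k

  hat-combination : ∀ {d n} {x : Point d} (c : Vector Carrier n) p →
                    sum c ≈ 1# → x ≋ combination c p → hat x ≋ combination c (hat ∘ p)
  hat-combination c p Σc≈1 x≋ zero    = sym (trans (·-oneʳ c) Σc≈1)
  hat-combination c p Σc≈1 x≋ (suc k) = x≋ k

  hat-combination⁻ : ∀ {d n} {x : Point d} (c : Vector Carrier n) p →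
                     hat x ≋ combination c (hat ∘ p) → sum c ≈ 1# × x ≋ combination c p
  hat-combination⁻ c p hx≋ = trans (sym (·-oneʳ c)) (sym (hx≋ zero)) , hx≋ ∘ suc

  Aff⇒Span : ∀ {d n} {X : PointSet d} {w : Vector (Point (suc d)) n} →
             (∀ {x} → x ∈ X → Span w (hat x)) → ∀ {x} → x ∈ Aff X → Span w (hat x)
  Aff⇒Span {w = w} X⊆ {x} (n , p , c , p∈X , Σc≈1 , x≋) =
    span-trans {q = w} {p = hat ∘ p} (X⊆ ∘ p∈X) (c , hat-combination {x = x} c p Σc≈1 x≋)

  Span⇒Aff : ∀ {d n} {p : Vector (Point d) n} {x} →
             Span (hat ∘ p) (hat x) → x ∈ Aff (λ y → ∃[ i ] y ≋ p i)
  Span⇒Aff {n = n} {p} {x} (c , hx≋) =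
    let Σc≈1 , x≋ = hat-combination⁻ {x = x} c p hx≋ in n , p , c , (λ i → i , ≋-refl) , Σc≈1 , x≋

  affinely⇒linearly : ∀ {d n} {p : Vector (Point d) n} → AffinelyIndependent p → LinearlyIndependent (hat ∘ p)
  affinely⇒linearly indep c cp≈0 = indep c (trans (sym (·-oneʳ c)) (cp≈0 zero)) (cp≈0 ∘ suc)

  linearly⇒affinely : ∀ {d n} {p : Vector (Point d) n} → LinearlyIndependent (hat ∘ p) → AffinelyIndependent p
  linearly⇒affinely indep c Σc≈0 cp≈0 = indep c λ where
    zero    → trans (·-oneʳ c) Σc≈0
    (suc k) → cp≈0 k

  -- The slack of the inequality a · x ≤ β as a linear functional on homogenised points.
  affine : ∀ {d} → Carrier → Point d → Point (suc d)
  affine β a = β ∷ λ k → - a k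

  affine-hat : ∀ {d} β (a x : Point d) → affine β a · hat x ≈ β - a · x
  affine-hat β a x = +-cong (*-identityʳ β) (·-negˡ a x)

  -- Vectors with coefficient zero may lie outside the span; replacing them by the zero vector
  -- changes no term of the combination.
  span-supported : ∀ {d m n} {q : Vector (Point d) n} (c : Vector Carrier m) (p : Vector (Point d) m) →
                   (∀ i → ¬ (c i ≈ 0#) → Span q (p i)) → Span q (combination c p)
  span-supported {q = q} c p p∈ =
    span-resp {q = q} (λ k → sum-cong-≋ λ i → c*p′≈c*p i k) (span-combination p′∈ c)
    where
    p′ : ∀ i → Dec (c i ≈ 0#) → Point _
    p′ i (yes _) = λ _ → 0#
    p′ i (no _)  = p i

    p′∈ : ∀ i → Span q (p′ i (em _))
    p′∈ i with em (c i ≈ 0#)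
    ... | yes _   = (λ _ → 0#) , λ k → sym (sum-zero λ j → zeroˡ (q j k))
    ... | no ci≉0 = p∈ i ci≉0

    c*p′≈c*p : ∀ i k → c i * p′ i (em _) k ≈ c i * p i k
    c*p′≈c*p i k with em (c i ≈ 0#)
    ... | yes ci≈0 = trans (zeroʳ (c i)) (sym (trans (*-congʳ ci≈0) (zeroˡ (p i k))))
    ... | no _     = refl

  -- Tilting a separating functional around its zeros makes new members of the
  -- family tight, until the tight ones and y span everything.
  record TightSeparation {d n} (h : Vector (Point d) n) (y : Point d) : Set where
    field
      f           : Point d
      nonNegative : ∀ j → 0# ≤ f · h j
      separates   : ¬ (0# ≤ f · y)
      {rank}      : ℕ
      ι           : Fin rank → Fin n
      independent : LinearlyIndependent (h ∘ ι)
      tight       : ∀ i → f · h (ι i) ≈ 0#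
      spansTight  : ∀ j → f · h j ≈ 0# → Span (h ∘ ι) (h j)
      spansAll    : ∀ j → Span (y ∷ (h ∘ ι)) (h j)

  -- As long as some `h j` lies outside the span of y and the tight members, `span-or-separated`
  -- supplies a tilting direction g that vanishes on that span but not at `h j`.
  tight-separation : ∀ {d n} (h : Vector (Point d) n) (y f : Point d) →
                     (∀ j → 0# ≤ f · h j) → ¬ (0# ≤ f · y) → TightSeparation h y
  tight-separation {d} {n} h y f₀ 0≤f₀ f₀-separates =
    tightness-induction {A = Separator} (λ (f , _) j → f · h j ≈ 0#) (λ _ → TightSeparation h y)
      (λ (f , 0≤f·h , 0≰f·y) rec → tilt f 0≤f·h 0≰f·y λ f′ 0≤ 0≰ → rec (f′ , 0≤ , 0≰))
      (f₀ , 0≤f₀ , f₀-separates)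
    where
    Separator : Set
    Separator = Σ (Point d) λ f → (∀ j → 0# ≤ f · h j) × ¬ (0# ≤ f · y)

    tilt : ∀ f → (∀ j → 0# ≤ f · h j) → ¬ (0# ≤ f · y) →
      (∀ f′ → (∀ j → 0# ≤ f′ · h j) → ¬ (0# ≤ f′ · y) →
        (∀ j → f · h j ≈ 0# → f′ · h j ≈ 0#) → (∃[ j ] f′ · h j ≈ 0# × ¬ (f · h j ≈ 0#)) →
        TightSeparation h y) →
      TightSeparation h y
    tilt f 0≤f·h 0≰f·y rec with independent-subfamily h (λ j → f · h j ≈ 0#)
    ... | r , ι , indep , tight , spans = decide (em _)
      where
      q = y ∷ (h ∘ ι)

      -- Adding multiples of g changes f neither at y nor at tight members, so f still separates;
      -- the ratio test stops when the first new member becomes tight.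
      along : ∀ g → (∀ i → g · q i ≈ 0#) → (∃[ j ] ¬ (0# ≤ g · h j)) → TightSeparation h y
      along g g⊥ negative with ratio-test (λ j → f · h j) (λ j → g · h j) 0≤f·h negative
      ... | t , _ , 0≤f+tg , j , 0≰g·hj , new =
        rec (shift f t g)
          (λ i → ≤-respʳ (sym (·-shiftˡ f t g (h i))) (0≤f+tg i))
          (λ 0≤f′·y → 0≰f·y (≤-respʳ (unchanged y (g⊥ zero)) 0≤f′·y))
          (λ i fhi≈0 → trans (unchanged (h i) (g⊥tight i fhi≈0)) fhi≈0)
          (j , trans (·-shiftˡ f t g (h j)) new , λ fhj≈0 → 0≰g·hj (≤-reflexive (sym (g⊥tight j fhj≈0))))
        where
        g⊥tight : ∀ i → f · h i ≈ 0# → g · h i ≈ 0#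
        g⊥tight i fhi≈0 = span-annihilated {q = h ∘ ι} g (g⊥ ∘ suc) (spans i fhi≈0)

        unchanged : ∀ z → g · z ≈ 0# → shift f t g · z ≈ f · z
        unchanged z g·z≈0 = begin
          shift f t g · z      ≈⟨ ·-shiftˡ f t g z ⟩
          f · z + t * (g · z)  ≈⟨ +-congˡ (*-congˡ g·z≈0) ⟩
          f · z + t * 0#       ≈⟨ solve 2 (λ s t → s :+ t :* con (+ 0) := s) refl (f · z) t ⟩
          f · z                ∎

      decide : Dec (∃[ j ] ¬ Span q (h j)) → TightSeparation h y
      decide (no all) = record
        { f = f ; nonNegative = 0≤f·h ; separates = 0≰f·y ; ι = ι ; independent = indep ; tight = tight
        ; spansTight = spans ; spansAll = λ j → decidable-stable (em _) λ hj∉ → all (j , hj∉) }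
      decide (yes (j , hj∉)) with span-or-separated q (h j)
      ... | inj₁ hj∈ = contradiction hj∈ hj∉
      -- The ratio test needs a negative value somewhere; one of g and its negative has it at `h j`.
      ... | inj₂ (g , g⊥ , g·hj≉0) with em (0# ≤ g · h j)
      ...   | no 0≰g·hj  = along g g⊥ (j , 0≰g·hj)
      ...   | yes 0≤g·hj = along -g
        (λ i → trans (·-negˡ g (q i)) (trans (-‿cong (g⊥ i)) -0#≈0#))
        (j , λ 0≤-g·hj → g·hj≉0 (antisym
          (0≤y-x⇒x≤y (≤-respʳ (trans (·-negˡ g (h j)) (sym (+-identityˡ _))) 0≤-g·hj)) 0≤g·hj))
        where
        -g : Point d
        -g k = - g k

  module _ {d} (P : Polytope d) where

    open Polytope P

    V∈points : ∀ j → V j ∈ points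
    V∈points j = proj₂ description
      (unit j , unit-nonNegative j , trans (sym (·-oneʳ (unit j))) (unit-· j (λ _ → 1#)) ,
       λ k → sym (unit-· j (λ i → V i k)))

    points⊆Span : ∀ {x} → x ∈ points → Span (hat ∘ V) (hat x)
    points⊆Span {x} x∈P =
      let c , _ , Σc≈1 , x≋ = proj₁ description x∈P in c , hat-combination {x = x} c V Σc≈1 x≋

    nonNegative-on-points : ∀ f → (∀ j → 0# ≤ f · hat (V j)) → ∀ {x} → x ∈ points → 0# ≤ f · hat x
    nonNegative-on-points f 0≤f·V {x} x∈P = let c , 0≤c , Σc≈1 , x≋ = proj₁ description x∈P in
      ≤-respʳ (sym (trans (·-congʳ f (hat-combination {x = x} c V Σc≈1 x≋)) (·-combination f c (hat ∘ V))))
        (sum-nonNegative λ j → *-nonNegative (0≤c j) (0≤f·V j))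

    points⊆Span-basis : ∀ {n′} {p : Vector (Point d) n′} → IsAffineBasis (Aff points) p →
                        ∀ {x} → x ∈ points → Span (hat ∘ p) (hat x)
    points⊆Span-basis {p = p} (_ , _ , spans) {x} x∈P = Aff⇒Span {X = λ z → ∃[ i ] z ≋ p i}
      (λ {z} (i , z≋pi) → span-resp {q = hat ∘ p} (hat-cong (≋-sym z≋pi)) (span-member (hat ∘ p) i)) {x}
      (spans (∈⇒∈Aff {X = points} x∈P))

    module _ {k n′} (k≡ : k ≡ + n′ ℤ.- + 1) {p : Vector (Point d) n′} (basis : IsAffineBasis (Aff points) p)
             {y : Point d} (y∈ : Span (hat ∘ p) (hat y)) (S : TightSeparation (hat ∘ V) (hat y)) where

      open TightSeparation S

      private
        h = hat ∘ V
        q = V ∘ ι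
        a = λ k → - f (suc k)
        β = f zero

        f·hat : ∀ x → f · hat x ≈ β - a · x
        f·hat x = trans
          (·-cong {x = f} {affine β a} {hat x}
            (λ { zero → refl ; (suc k) → solve 1 (λ s → s := :- :- s) refl (f (suc k)) }) ≋-refl)
          (affine-hat β a x)

        ·≈⇒f≈0 : ∀ {x} → a · x ≈ β → f · hat x ≈ 0#
        ·≈⇒f≈0 {x} a·x≈β = trans (f·hat x) (trans (+-congˡ (-‿cong a·x≈β)) (-‿inverseʳ β))

        f≈0⇒·≈ : ∀ {x} → f · hat x ≈ 0# → a · x ≈ β
        f≈0⇒·≈ {x} f≈0 = begin
          a · x                ≈⟨ solve 2 (λ b s → s := b :- (b :- s)) refl β (a · x) ⟩
          β - (β - a · x)      ≈⟨ +-congˡ (-‿cong (trans (sym (f·hat x)) f≈0)) ⟩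
          β - 0#               ≈⟨ solve 1 (λ b → b :- con (+ 0) := b) refl β ⟩
          β                    ∎

        q∈Face : ∀ i → q i ∈ Face points a β
        q∈Face i = V∈points (ι i) , f≈0⇒·≈ {q i} (tight i)

        -- At x, f is a sum of nonnegative terms equal to zero. Hence the convex combination for x
        -- gives weight only to members of `V` where f vanishes, and these lie in the span of the
        -- chosen tight ones.
        Face⊆Span : ∀ {x} → x ∈ Face points a β → Span (hat ∘ q) (hat x)
        Face⊆Span {x} (x∈P , a·x≈β) =
          let c , 0≤c , Σc≈1 , x≋ = proj₁ description x∈P
              hx≋ = hat-combination {x = x} c V Σc≈1 x≋
              c*f≈0 = sum≈0⇒≈0 (λ j → *-nonNegative (0≤c j) (nonNegative j))
                        (trans (sym (trans (·-congʳ f hx≋) (·-combination f c h))) (·≈⇒f≈0 {x} a·x≈β))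
          in span-resp {q = hat ∘ q} (≋-sym hx≋)
               (span-supported c h λ j cj≉0 → spansTight j (xy≈0⇒y≈0 cj≉0 (c*f≈0 j)))

        p⊆Span : ∀ i → Span h (hat (p i))
        p⊆Span i = Aff⇒Span {X = points} points⊆Span {p i} (proj₁ basis i)

        -- The homogenised basis p and the family of y and the tight points are both independent,
        -- and each lies in the span of the other. Independence of the latter holds because f
        -- vanishes on the tight points but not at y. Consequently the face has dimension one less
        -- than P.
        rank-suc : n′ ≡ suc rank
        rank-suc = ℕ.≤-antisym
          (independent-in-span {p = hat y ∷ (hat ∘ q)} (affinely⇒linearly (proj₁ (proj₂ basis)))
            λ i → span-trans {q = hat y ∷ (hat ∘ q)} spansAll (p⊆Span i))
          (independent-in-span {w = hat y ∷ (hat ∘ q)}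
            (independent-∷ {q = hat y ∷ (hat ∘ q)} independent
              λ y∈q → separates (≤-reflexive (sym (span-annihilated {q = hat ∘ q} f tight y∈q))))
            λ { zero → y∈ ; (suc i) → points⊆Span-basis basis (V∈points (ι i)) })

      facet : FacetDefining points a β
      facet =
        (λ {x} x∈P → 0≤y-x⇒x≤y (≤-respʳ (f·hat x) (nonNegative-on-points f nonNegative x∈P))) ,
        k , (n′ , k≡ , p , basis) ,
        (rank , dim≡ , q , (λ i → ∈⇒∈Aff {X = Face points a β} (q∈Face i)) , linearly⇒affinely independent ,
         λ {x} x∈ → Span⇒Aff {x = x} (Aff⇒Span {X = Face points a β} Face⊆Span {x} x∈))
        where
        dim≡ : k ℤ.- + 1 ≡ + rank ℤ.- + 1
        dim≡ = ≡.trans (≡.cong (ℤ._- + 1) k≡) (≡.cong (λ n → + n ℤ.- + 1 ℤ.- + 1) rank-suc)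

      -- Over y and the tight points q, a point h j has some coefficient c₀ at y.
      -- Both functionals vanish on q, so each takes c₀ times its value at y on h j.
      same-facet-violated : ∀ {a′ β′} → FacetDefining points a′ β′ →
                            Face points a′ β′ ≐ Face points a β → ¬ (0# ≤ β′ - a′ · y)
      same-facet-violated {a′} {β′} (valid , _) (⊆F , ⊇F) 0≤g·y with em (∃[ j ] ¬ (f · h j ≈ 0#))
      ... | no all-tight = separates (≤-reflexive (sym (span-annihilated {q = h} f
              (λ j → decidable-stable (em _) λ ≉0 → all-tight (j , ≉0)) (span-trans {q = h} p⊆Span y∈))))
      ... | yes (j , f·hj≉0) = f·hj≉0 (·≈⇒f≈0 {V j} (proj₂ (⊆F (V∈points j , a′·Vj≈β′))))
        where
        g = affine β′ a′
        c = proj₁ (spansAll j)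
        c₀ = c zero

        through-y : ∀ e → (∀ i → e · hat (q i) ≈ 0#) → e · h j ≈ c₀ * (e · hat y)
        through-y e e⊥ = begin
          e · h j                                           ≈⟨ ·-congʳ e (proj₂ (spansAll j)) ⟩
          e · combination c (hat y ∷ (hat ∘ q))             ≈⟨ ·-combination e c (hat y ∷ (hat ∘ q)) ⟩
          c₀ * (e · hat y) + tail c · (λ i → e · hat (q i)) ≈⟨ +-congˡ (·-zeroʳ (tail c) e⊥) ⟩
          c₀ * (e · hat y) + 0#                             ≈⟨ +-identityʳ _ ⟩
          c₀ * (e · hat y)                                  ∎

        c₀≤0 : c₀ ≤ 0#
        c₀≤0 with total c₀ 0#
        ... | inj₁ c₀≤0 = c₀≤0
        ... | inj₂ 0≤c₀ = contradiction
          (antisym (≤-resp-≈ (sym (through-y f tight)) (zeroʳ c₀) (*-monoˡ-≤-nonNeg c₀ 0≤c₀ (≰⇒≥ separates)))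
                   (nonNegative j)) f·hj≉0

        g⊥ : ∀ i → g · hat (q i) ≈ 0#
        g⊥ i = trans (affine-hat β′ a′ (q i)) (trans (+-congˡ (-‿cong (proj₂ (⊇F (q∈Face i))))) (-‿inverseʳ β′))

        g·hj≤0 : β′ - a′ · V j ≤ 0#
        g·hj≤0 = ≤-resp-≈
          (begin
            (β′ - a′ · y) * c₀   ≈⟨ *-comm _ c₀ ⟩
            c₀ * (β′ - a′ · y)   ≈⟨ *-congˡ (affine-hat β′ a′ y) ⟨
            c₀ * (g · hat y)     ≈⟨ through-y g g⊥ ⟨
            g · h j              ≈⟨ affine-hat β′ a′ (V j) ⟩
            β′ - a′ · V j        ∎)
          (zeroʳ _) (*-monoˡ-≤-nonNeg (β′ - a′ · y) 0≤g·y c₀≤0)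

        a′·Vj≈β′ : a′ · V j ≈ β′
        a′·Vj≈β′ = antisym (valid (V∈points j)) (0≤y-x⇒x≤y (≤-respʳ
          (solve 2 (λ b s → :- (b :- s) := s :- b) refl β′ (a′ · V j)) (neg-nonNegative g·hj≤0)))

    -- If a row of the description failed at y, it would be a separating functional; tilted, it
    -- defines a facet, which by `exhaustive` is also the face of some listed inequality. That
    -- inequality must then fail at y too.
    facet-inequalities-suffice : ∀ {k n′} → k ≡ + n′ ℤ.- + 1 →
      {p : Vector (Point d) n′} → IsAffineBasis (Aff points) p →
      (F : FacetSystem points) → ∀ {y} → Span (hat ∘ p) (hat y) →
      (∀ i → 0# ≤ FacetSystem.offset F i - FacetSystem.normal F i · y) → y ∈ points
    facet-inequalities-suffice k≡ basis F {y} y∈ 0≤slack i₀ = decidable-stable (em _) λ violated →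
      let S = tight-separation (hat ∘ V) (hat y) (affine (b i₀) (A i₀))
                (λ j → ≤-respʳ (sym (affine-hat (b i₀) (A i₀) (V j))) (x≤y⇒0≤y-x (V∈points j i₀)))
                (λ 0≤ → violated (0≤y-x⇒x≤y (≤-respʳ (affine-hat (b i₀) (A i₀) y) 0≤)))
          i , same = FacetSystem.exhaustive F _ _ (facet k≡ basis y∈ S)
      in same-facet-violated k≡ basis y∈ S (FacetSystem.facetDefining F i) same (0≤slack i)

-- Positive semidefinite matrices and the extended formulation

module Semidefinite (ℝ : RealField) where

  open RealField ℝ hiding (zero)
  open Polytopes ℝ
  open IntegerSolver ℝ
  open RealProperties ℝ
  open LinearAlgebra ℝ
  open Vertices ℝ
  open Facets ℝ
  open Algebra.Properties.Semiring.Sum semiring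
  open Data.Vec.Functional.Relation.Binary.Equality.Setoid setoid using (_≋_; ≋-refl; ≋-sym; ≋-trans)
  open Relation.Binary.Reasoning.Setoid setoid

  outer : ∀ {r} → Vector Carrier r → Matrix r r
  outer z i j = z i * z j

  quadratic : ∀ {r} → Matrix r r → Vector Carrier r → Carrier
  quadratic {r} M x = ∑[ i < r ] ∑[ j < r ] (x i * M i j * x j)

  quadratic-frobenius : ∀ {r} (M : Matrix r r) x → quadratic M x ≈ frobenius (outer x) M
  quadratic-frobenius M x = sum-cong-≋ λ i → sum-cong-≋ λ j →
    solve 3 (λ x m y → x :* m :* y := x :* y :* m) refl (x i) (M i j) (x j)

  frobenius-outer : ∀ {r} (x y : Vector Carrier r) → frobenius (outer x) (outer y) ≈ (x · y) * (x · y)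
  frobenius-outer {r} x y = begin
    ∑[ i < r ] ∑[ j < r ] (x i * x j * (y i * y j))
      ≈⟨ sum-cong-≋ (λ i → sum-cong-≋ λ j →
           solve 4 (λ a b c d → a :* b :* (c :* d) := a :* c :* (b :* d)) refl (x i) (x j) (y i) (y j)) ⟩
    ∑[ i < r ] ∑[ j < r ] (x i * y i * (x j * y j))
      ≈⟨ sum-cong-≋ (λ i → *-distribˡ-sum (x i * y i) (λ j → x j * y j)) ⟨
    ∑[ i < r ] (x i * y i * (x · y))
      ≈⟨ *-distribʳ-sum (x · y) (λ i → x i * y i) ⟨
    (x · y) * (x · y) ∎

  outer-PSD : ∀ {r} (y : Vector Carrier r) → PSD (outer y)
  outer-PSD y = (λ i j → *-comm (y i) (y j)) , λ x → ≤-respʳ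
    (sym (trans (quadratic-frobenius (outer y) x) (frobenius-outer x y))) (square-nonNegative (x · y))

  mix : ∀ {r} → Carrier → Matrix r r → Carrier → Matrix r r → Matrix r r
  mix s Y t Z i j = s * Y i j + t * Z i j

  ·-scaleʳ : ∀ {n} (f : Point n) s x → f · (λ k → s * x k) ≈ s * (f · x)
  ·-scaleʳ f s x = trans
    (sum-cong-≋ λ k → solve 3 (λ f s x → f :* (s :* x) := s :* (f :* x)) refl (f k) s (x k))
    (sym (*-distribˡ-sum s (λ k → f k * x k)))

  ·-mix : ∀ {n} (f : Point n) s x t y → f · shift (λ k → s * x k) t y ≈ s * (f · x) + t * (f · y)
  ·-mix f s x t y = trans (·-shiftʳ f (λ k → s * x k) t y) (+-congʳ (·-scaleʳ f s x))

  frobenius-mix : ∀ {r} (N : Matrix r r) s Y t Z →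
                  frobenius N (mix s Y t Z) ≈ s * frobenius N Y + t * frobenius N Z
  frobenius-mix {r} N s Y t Z = begin
    ∑[ i < r ] (N i · mix s Y t Z i)
      ≈⟨ sum-cong-≋ (λ i → ·-mix (N i) s (Y i) t (Z i)) ⟩
    ∑[ i < r ] (s * (N i · Y i) + t * (N i · Z i))
      ≈⟨ ∑-distrib-+ (λ i → s * (N i · Y i)) (λ i → t * (N i · Z i)) ⟩
    ∑[ i < r ] (s * (N i · Y i)) + ∑[ i < r ] (t * (N i · Z i))
      ≈⟨ +-cong (*-distribˡ-sum s (λ i → N i · Y i)) (*-distribˡ-sum t (λ i → N i · Z i)) ⟨
    s * frobenius N Y + t * frobenius N Z                         ∎

  mix-PSD : ∀ {r s t} {Y Z : Matrix r r} → 0# ≤ s → 0# ≤ t → PSD Y → PSD Z → PSD (mix s Y t Z)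
  mix-PSD {s = s} {t} {Y} {Z} 0≤s 0≤t (Y-sym , 0≤Y) (Z-sym , 0≤Z) =
    (λ i j → +-cong (*-congˡ (Y-sym i j)) (*-congˡ (Z-sym i j))) ,
    λ x → ≤-respʳ
      (begin
        s * quadratic Y x + t * quadratic Z x
          ≈⟨ +-cong (*-congˡ (quadratic-frobenius Y x)) (*-congˡ (quadratic-frobenius Z x)) ⟩
        s * frobenius (outer x) Y + t * frobenius (outer x) Z          ≈⟨ frobenius-mix (outer x) s Y t Z ⟨
        frobenius (outer x) (mix s Y t Z)
          ≈⟨ quadratic-frobenius (mix s Y t Z) x ⟨
        quadratic (mix s Y t Z) x                                      ∎)
      (+-nonNegative (*-nonNegative 0≤s (0≤Y x)) (*-nonNegative 0≤t (0≤Z x)))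

  -- Pairing with this matrix reads off a linear form in the first row of a symmetric Y. Symmetry
  -- makes each entry count twice, which is the source of every factor `2#` below.
  border : ∀ {n} → Vector Carrier n → Matrix (suc n) (suc n)
  border w = (0# ∷ w) ∷ λ l → w l ∷ λ _ → 0#

  border-symmetric : ∀ {n} (w : Vector Carrier n) → Symmetric (border w)
  border-symmetric w zero    zero    = refl
  border-symmetric w zero    (suc j) = refl
  border-symmetric w (suc i) zero    = refl
  border-symmetric w (suc i) (suc j) = refl

  frobenius-border : ∀ {n} (w : Vector Carrier n) {Y} → Symmetric Y →
                     frobenius (border w) Y ≈ 2# * (tail (head Y) · w)
  frobenius-border {n} w {Y} Y-sym = begin
    (0# * Y zero zero + w · y) + ∑[ l < n ] (w l * Y (suc l) zero + ∑[ j < n ] (0# * Y (suc l) (suc j)))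
      ≈⟨ +-cong (trans (+-congʳ (zeroˡ _)) (+-identityˡ _))
           (sum-cong-≋ λ l → trans
             (+-cong (*-congˡ (Y-sym (suc l) zero)) (sum-zero {f = λ j → 0# * Y (suc l) (suc j)} λ j → zeroˡ _))
             (+-identityʳ _)) ⟩
    w · y + w · y   ≈⟨ +-cong (·-comm w y) (·-comm w y) ⟩
    y · w + y · w   ≈⟨ solve 1 (λ s → s :+ s := (con (+ 1) :+ con (+ 1)) :* s) refl (y · w) ⟩
    2# * (y · w)    ∎
    where y = tail (head Y)

  formulation : ∀ {d} (P : Polytope d) → let open Polytope P in
    (F : FacetSystem points) (W : VertexSystem points) → Is0/1 (slackMatrix F W) →
    ∀ {k n′} → k ≡ + n′ ℤ.- + 1 → {p : Vector (Point d) n′} → IsAffineBasis (Aff points) p →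
    SDPFormulation points (suc n′)
  formulation {d} P F W S01 {n′ = n′} k≡ {p} basis = record
    { E = E ; F = N ; F-symmetric = N-symmetric ; g = g
    ; projects = (λ {x} x∈P → vertex-induction P Lift Lift-resp Lift-convex Lift-vertex x∈P)
               , λ {x} lift → lifted⇒∈ x lift
    }
    where
    open Polytope P
    open FacetSystem F using (normal; offset) renaming (size to s)
    open VertexSystem W using (vertex)

    -- The leading zero restricts the form to the lower right block; the other entries are the
    -- slacks of inequality i at the basis points.
    z : Fin s → Vector Carrier (suc n′)
    z i = 0# ∷ λ l → affine (offset i) (normal i) · hat (p l)

    column : Fin (suc d) → Vector Carrier n′
    column κ l = hat (p l) κ

    -- These equations, doubled to match `border`, express that x is the affine combination of p
    -- given by the first row of Y: index zero says that the weights sum to 1, index `suc κ`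
    -- compares coordinate κ.
    E₁ : Fin (suc d) → Point d
    E₁ zero    = λ _ → 0#
    E₁ (suc κ) = λ k → - 2# * unit κ k

    g₁ : Fin (suc d) → Carrier
    g₁ zero    = 2#
    g₁ (suc κ) = 0#

    E : Vector (Point d) (suc d ℕ.+ s)
    E = E₁ ++ normal

    N : Vector (Matrix (suc n′) (suc n′)) (suc d ℕ.+ s)
    N = (border ∘ column) ++ (outer ∘ z)

    g : Vector Carrier (suc d ℕ.+ s)
    g = g₁ ++ offset

    N-symmetric : ∀ e → Symmetric (N e)
    N-symmetric e with splitAt (suc d) e
    ... | inj₁ κ = border-symmetric (column κ)
    ... | inj₂ i = λ j l → *-comm (z i j) (z i l)

    Holds : Point d → Matrix (suc n′) (suc n′) → Fin (suc d ℕ.+ s) → Set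
    Holds x Y e = E e · x + frobenius (N e) Y ≈ g e

    Lift : Point d → Set
    Lift x = Σ (Matrix (suc n′) (suc n′)) λ Y → PSD Y × (∀ e → Holds x Y e)

    Lift-resp : ∀ {x y} → x ≋ y → Lift x → Lift y
    Lift-resp x≋y (Y , psd , holds) = Y , psd , λ e → trans (+-congʳ (·-congʳ (E e) (≋-sym x≋y))) (holds e)

    Lift-convex : ∀ {x y} s t → 0# ≤ s → 0# ≤ t → s + t ≈ 1# →
                  Lift x → Lift y → Lift (shift (λ k → s * x k) t y)
    Lift-convex {x} {y} s t 0≤s 0≤t s+t≈1 (Y , Y-psd , Y-holds) (Z , Z-psd , Z-holds) =
      mix s Y t Z , mix-PSD 0≤s 0≤t Y-psd Z-psd , λ e → begin
        E e · shift (λ k → s * x k) t y + frobenius (N e) (mix s Y t Z)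
          ≈⟨ +-cong (·-mix (E e) s x t y) (frobenius-mix (N e) s Y t Z) ⟩
        s * (E e · x) + t * (E e · y) + (s * frobenius (N e) Y + t * frobenius (N e) Z)
          ≈⟨ solve 6 (λ s t a b c d → s :* a :+ t :* b :+ (s :* c :+ t :* d) := s :* (a :+ c) :+ t :* (b :+ d))
               refl s t (E e · x) (E e · y) (frobenius (N e) Y) (frobenius (N e) Z) ⟩
        s * (E e · x + frobenius (N e) Y) + t * (E e · y + frobenius (N e) Z)
          ≈⟨ +-cong (*-congˡ (Y-holds e)) (*-congˡ (Z-holds e)) ⟩
        s * g e + t * g e
          ≈⟨ distribʳ (g e) s t ⟨
        (s + t) * g e
          ≈⟨ trans (*-congʳ s+t≈1) (*-identityˡ (g e)) ⟩
        g e ∎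

    E₁+2hat≈g₁ : ∀ x κ → E₁ κ · x + 2# * hat x κ ≈ g₁ κ
    E₁+2hat≈g₁ x zero = trans
      (+-cong (sum-zero {f = λ k → 0# * x k} λ k → zeroˡ (x k)) (*-identityʳ 2#))
      (+-identityˡ 2#)
    E₁+2hat≈g₁ x (suc κ) = begin
      (λ k → - 2# * unit κ k) · x + 2# * x κ
        ≈⟨ +-congʳ (trans (·-comm _ x) (trans (·-scaleʳ x (- 2#) (unit κ))
             (*-congˡ (trans (·-comm x (unit κ)) (unit-· κ x))))) ⟩
      - 2# * x κ + 2# * x κ
        ≈⟨ solve 2 (λ a x → :- a :* x :+ a :* x := con (+ 0)) refl 2# (x κ) ⟩
      0# ∎

    z·∷ : ∀ i {x} y₀ c → hat x ≋ combination c (hat ∘ p) → z i · (y₀ ∷ c) ≈ offset i - normal i · x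
    z·∷ i {x} y₀ c hx≋ = begin
      0# * y₀ + (λ l → aff · hat (p l)) · c     ≈⟨ trans (+-congʳ (zeroˡ y₀)) (+-identityˡ _) ⟩
      (λ l → aff · hat (p l)) · c                ≈⟨ ·-comm _ c ⟩
      c · (λ l → aff · hat (p l))                ≈⟨ ·-combination aff c (hat ∘ p) ⟨
      aff · combination c (hat ∘ p)              ≈⟨ ·-congʳ aff hx≋ ⟨
      aff · hat x                                ≈⟨ affine-hat (offset i) (normal i) x ⟩
      offset i - normal i · x                    ∎
      where aff = affine (offset i) (normal i)

    Lift-vertex : ∀ {v} → IsVertex points v → Lift v
    Lift-vertex {v} isVertex = outer y , outer-PSD y , holds
      where
      v∈ : Span (hat ∘ p) (hat v)
      v∈ = points⊆Span-basis P basis (proj₁ (proj₂ (proj₂ (proj₂ (proj₂ isVertex)))))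

      c = proj₁ v∈
      y = 1# ∷ c

      idempotent : ∀ {σ} → σ ≈ 0# ⊎ σ ≈ 1# → σ * σ ≈ σ
      idempotent {σ} (inj₁ σ≈0) = trans (*-congʳ σ≈0) (trans (zeroˡ σ) (sym σ≈0))
      idempotent {σ} (inj₂ σ≈1) = trans (*-congʳ σ≈1) (*-identityˡ σ)

      -- The slacks of v form a column of the slack matrix, because v coincides with a listed
      -- vertex.
      slack01 : ∀ i → (offset i - normal i · v) ≈ 0# ⊎ (offset i - normal i · v) ≈ 1#
      slack01 i with VertexSystem.exhaustive W v isVertex
      ... | j , vj≋v with S01 i j
      ...   | inj₁ σ≈0 = inj₁ (trans (+-congˡ (-‿cong (·-congʳ (normal i) (≋-sym vj≋v)))) σ≈0)
      ...   | inj₂ σ≈1 = inj₂ (trans (+-congˡ (-‿cong (·-congʳ (normal i) (≋-sym vj≋v)))) σ≈1)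

      holds : ∀ e → Holds v (outer y) e
      holds e with splitAt (suc d) e
      ... | inj₁ κ = begin
        E₁ κ · v + frobenius (border (column κ)) (outer y)
          ≈⟨ +-congˡ (frobenius-border (column κ) {outer y} (proj₁ (outer-PSD y))) ⟩
        E₁ κ · v + 2# * ((λ l → 1# * c l) · column κ)
          ≈⟨ +-congˡ (*-congˡ (trans (sum-cong-≋ λ l → *-congʳ (*-identityˡ (c l))) (sym (proj₂ v∈ κ)))) ⟩
        E₁ κ · v + 2# * hat v κ
          ≈⟨ E₁+2hat≈g₁ v κ ⟩
        g₁ κ ∎
      ... | inj₂ i = begin
        normal i · v + frobenius (outer (z i)) (outer y)
          ≈⟨ +-congˡ (trans (frobenius-outer (z i) y) (*-cong z·y≈σ z·y≈σ)) ⟩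
        normal i · v + (offset i - normal i · v) * (offset i - normal i · v)
          ≈⟨ +-congˡ (idempotent (slack01 i)) ⟩
        normal i · v + (offset i - normal i · v)
          ≈⟨ solve 2 (λ a b → a :+ (b :- a) := b) refl (normal i · v) (offset i) ⟩
        offset i ∎
        where z·y≈σ = z·∷ i {v} 1# c (proj₂ v∈)

    lifted⇒∈ : ∀ x → Lift x → x ∈ points
    lifted⇒∈ x (Y , (Y-sym , 0≤Y) , holds) =
      facet-inequalities-suffice P k≡ basis F {x} (c , hx≋) 0≤slack
      where
      c = tail (head Y)

      holds₁ : ∀ κ → E₁ κ · x + frobenius (border (column κ)) Y ≈ g₁ κ
      holds₁ κ = ≡.subst₂ _≈_
        (≡.cong₂ (λ a M → a · x + frobenius M Y) (lookup-++ˡ E₁ normal κ)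
          (lookup-++ˡ (border ∘ column) (outer ∘ z) κ))
        (lookup-++ˡ g₁ offset κ) (holds (κ ↑ˡ s))

      holds₂ : ∀ i → normal i · x + frobenius (outer (z i)) Y ≈ offset i
      holds₂ i = ≡.subst₂ _≈_
        (≡.cong₂ (λ a M → a · x + frobenius M Y) (lookup-++ʳ E₁ normal i)
          (lookup-++ʳ (border ∘ column) (outer ∘ z) i))
        (lookup-++ʳ g₁ offset i) (holds (suc d ↑ʳ i))

      hx≋ : hat x ≋ combination c (hat ∘ p)
      hx≋ κ = begin
        hat x κ                     ≈⟨ solve 2 (λ h c → h := h :- c :+ c) refl (hat x κ) (c · column κ) ⟩
        hat x κ - c · column κ + c · column κ   ≈⟨ +-congʳ (xy≈0⇒y≈0 2≉0 difference≈0) ⟩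
        0# + c · column κ          ≈⟨ +-identityˡ _ ⟩
        c · column κ                ∎
        where
        -- `hat x κ` and `c · column κ` satisfy the same equation with coefficient `2#`, one
        -- identically and the other by feasibility of Y.
        difference≈0 : 2# * (hat x κ - c · column κ) ≈ 0#
        difference≈0 = begin
          2# * (hat x κ - c · column κ)
            ≈⟨ solve 4 (λ a e h c → a :* (h :- c) := (e :+ a :* h) :- (e :+ a :* c))
                 refl 2# (E₁ κ · x) (hat x κ) (c · column κ) ⟩
          E₁ κ · x + 2# * hat x κ - (E₁ κ · x + 2# * (c · column κ))
            ≈⟨ +-cong (E₁+2hat≈g₁ x κ)
                 (-‿cong (trans (+-congˡ (sym (frobenius-border (column κ) {Y} Y-sym))) (holds₁ κ))) ⟩
          g₁ κ - g₁ κ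
            ≈⟨ -‿inverseʳ (g₁ κ) ⟩
          0# ∎

      0≤slack : ∀ i → 0# ≤ offset i - normal i · x
      -- The slack equals the quadratic form of Y at `z i`.
      0≤slack i = ≤-respʳ
        (begin
          quadratic Y (z i)                                       ≈⟨ quadratic-frobenius Y (z i) ⟩
          frobenius (outer (z i)) Y
            ≈⟨ solve 2 (λ a f → f := a :+ f :- a) refl (normal i · x) (frobenius (outer (z i)) Y) ⟩
          normal i · x + frobenius (outer (z i)) Y - normal i · x ≈⟨ +-congʳ (holds₂ i) ⟩
          offset i - normal i · x                                 ∎)
        (0≤Y (z i))

  -- The extension complexity is an attained minimum, so beyond one formulation a least size must be
  -- exhibited. Excluded middle decides at each size whether a smaller one works.
  least : (Q : ℕ → Set) → ∀ {n} → Q n → ∃[ r ] (Q r × (∀ m → Q m → r ℕ.≤ m)) × r ℕ.≤ n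
  least Q {n} Qn = go n Qn (<-wellFounded n)
    where
    go : ∀ n → Q n → Acc ℕ._<_ n → ∃[ r ] (Q r × (∀ m → Q m → r ℕ.≤ m)) × r ℕ.≤ n
    go n Qn (acc rs) with em (∃[ m ] m ℕ.< n × Q m)
    ... | no none = n , (Qn , λ m Qm → ℕ.≮⇒≥ λ m<n → none (m , m<n , Qm)) , ℕ.≤-refl
    ... | yes (m , m<n , Qm) = let r , minimal , r≤m = go m Qm (rs m<n) in
            r , minimal , ℕ.≤-trans r≤m (ℕ.<⇒≤ m<n)

open import Data.Integer.Base using (_+_; _≤_)

corollary17 : (ℝ : RealField) → let open Polytopes ℝ in
    ∀ {d : ℕ} (P : Polytope d) →
    (F : FacetSystem (Polytope.points P)) (W : VertexSystem (Polytope.points P)) →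
    Is0/1 (slackMatrix F W) →
    ∀ (k : ℤ) → HasDim (Polytope.points P) k →
    ∃[ r ] IsXcSDP (Polytope.points P) r × + r ≤ k + + 2
corollary17 ℝ P F W S01 k (n , k≡ , p , basis) =
  let open Semidefinite ℝ
      r , isXc , r≤1+n = least (Polytopes.SDPFormulation ℝ (Polytopes.Polytope.points P))
                             (formulation P F W S01 k≡ basis)
  in r , isXc , ℤ.≤-trans (ℤ.+≤+ r≤1+n) (ℤ.≤-reflexive (1+n≡k+2 k≡))
  where
  -- An affine basis has n = k + 1 points and the first row of Y adds one. The empty polytope, with
  -- k = -1 and n = 0, is covered.
  1+n≡k+2 : k ≡ + n ℤ.- + 1 → + suc n ≡ k + + 2
  1+n≡k+2 k≡ = ≡.trans (≡.cong +_ (ℕ.+-comm 1 n))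
    (≡.trans (≡.sym (ℤ.+-assoc (+ n) (ℤ.- + 1) (+ 2))) (≡.cong (_+ + 2) (≡.sym k≡)))
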